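{- Let $w\in S_\infty$ and let $i$ be such that $l(ws_i)=l(w)-1$. Then: (1) the sets $\mathrm{mitosis}'_i(D)$, $D\in\mathcal{P}_s(w)$, are pairwise disjoint and $\bigsqcup_{D\in\mathcal{P}_s(w)}\mathrm{mitosis}'_i(D)=\mathcal{P}(ws_i)$; (2) the sets $\mathrm{mitosis}'_i(D)$, $D\in\mathcal{P}_I(w)$, are pairwise disjoint and $\bigsqcup_{D\in\mathcal{P}_I(w)}\mathrm{mitosis}'_i(D)=\mathcal{P}_\varnothing(w)$.
   Context: $S_\infty=\bigcup_n S_n$, generated by $s_k=(k,k+1)$; $l(u)$ is the Coxeter length. A pipe dream is a finite subset $D\subset\mathbb{Z}_{>0}\times\mathbb{Z}_{>0}$ (elements $(r,c)$, row $r$, column $c$, are called crosses); the antidiagonal index of $(r,c)$ is $r+c-1$. The word of $D$ is the sequence of antidiagonal indices of its crosses read row by row from top to bottom, each row from right to left. The Demazure product of a word $(a_1,\dots,a_k)$: start with $u=\mathrm{id}$, and for $t=1,\dots,k$ replace $u$ by $us_{a_t}$ if $l(us_{a_t})=l(u)+1$, otherwise keep $u$. $\mathcal{P}(v)$ is the set of pipe dreams whose word has Demazure product $v$. Mitosis. For a pipe dream $D$ let $\mathrm{start}_i(D)=\min\{j:(i,j)\notin D\}$ and $\mathcal{J}_i(D)=\{j<\mathrm{start}_i(D):(i+1,j)\notin D\}$. For $p\in\mathcal{J}_i(D)$, $D_p$ is obtained from $D$ by deleting the cross $(i,p)$ and then, for every $j\in\mathcal{J}_i(D)$ with $j<p$,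 moving the cross $(i,j)$ down to $(i+1,j)$. $\mathrm{mitosis}_i(D)=\{D_p:p\in\mathcal{J}_i(D)\}$. Writing $\mathcal{J}_i(D)=\{j_1<j_2<\dots<j_k\}$, define $\mathrm{mitosis}'_i(D)=\{D_{j_1},\,D_{j_1}\cup D_{j_2},\,D_{j_2},\,D_{j_2}\cup D_{j_3},\,\dots,\,D_{j_{k-1}},\,D_{j_{k-1}}\cup D_{j_k},\,D_{j_k}\}$ (empty if $k=0$). Partition of $\mathcal{P}(w)$ (for this fixed $i$ with $l(ws_i)=l(w)-1$): $\mathcal{P}_\varnothing(w)=\{D\in\mathcal{P}(w):\mathrm{mitosis}_i(D)=\emptyset\}$; $\mathcal{P}_s(w)=\{D\in\mathcal{P}(w):\mathrm{mitosis}_i(D)\ne\emptyset,\ \mathrm{mitosis}_i(D)\subseteq\mathcal{P}(ws_i)\}$; $\mathcal{P}_I(w)=\{D\in\mathcal{P}(w):\mathrm{mitosis}_i(D)\ne\emptyset,\ \mathrm{mitosis}_i(D)\subseteq\mathcal{P}(w)\}$. -}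

module Defs where

open import Data.Nat using (ℕ; zero; suc; _+_; _∸_; _≤_; _<_; _⊔_; _≡ᵇ_; _<ᵇ_)
open import Data.Bool using (Bool; true; false; if_then_else_; not; _∧_; _∨_)
open import Data.Product using (_×_; _,_; Σ)
open import Data.List using (List; []; _∷_; _++_; map; concatMap; upTo; reverse; foldr; filterᵇ; length)
open import Data.Nat.ListAction using (sum)
open import Data.Bool.ListAction using (any)
open import Data.List.Membership.Propositional using (_∈_)
open import Data.List.Relation.Unary.All using (All)
open import Data.List.Relation.Unary.Any using (Any)
open import Relation.Binary.PropositionalEquality using (_≡_)
open import Relation.Nullary using (¬_)

-- Permutations in S_∞ (bijections of ℤ_{>0} with finite support).
-- Position 0 is a dummy, fixed point; positions 1,2,... are the
-- positive integers.  fn k = w(k).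

record Perm : Set where
  field
    fn     : ℕ → ℕ
    bound  : ℕ
    fn-fix : ∀ k → bound < k → fn k ≡ k
    fn-0   : fn 0 ≡ 0
    fn-inj : ∀ a b → fn a ≡ fn b → a ≡ b
open Perm public

range : ℕ → List ℕ
range n = map suc (upTo n)

-- number of inversions of f among positions 1..N
-- (= Coxeter length of f whenever f fixes every position > N)
len : ℕ → (ℕ → ℕ) → ℕ
len N f = sum (map (λ a → sum (map (λ b →
            if (a <ᵇ b) ∧ (f b <ᵇ f a) then 1 else 0) (range N))) (range N))

swap : ℕ → ℕ → ℕ
swap a k = if k ≡ᵇ a then suc a else (if k ≡ᵇ suc a then a else k)

_·s_ : (ℕ → ℕ) → ℕ → (ℕ → ℕ)
(u ·s a) k = u (swap a k)

ℓ : Perm → ℕ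
ℓ w = len (bound w) (fn w)

-- Coxeter length l(w s_i)  (w s_i fixes every position > bound w ⊔ suc i)
ℓ·s : Perm → ℕ → ℕ
ℓ·s w i = len (bound w ⊔ suc i) (fn w ·s i)

maxList : List ℕ → ℕ
maxList = foldr _⊔_ 0

-- N bounds the support of all permutations occurring
demazureGo : ℕ → (ℕ → ℕ) → List ℕ → (ℕ → ℕ)
demazureGo N u [] = u
demazureGo N u (a ∷ as) =
  if len N (u ·s a) ≡ᵇ suc (len N u)
  then demazureGo N (u ·s a) as
  else demazureGo N u as

demazure : List ℕ → (ℕ → ℕ)
demazure ws = demazureGo (suc (maxList ws)) (λ k → k) ws

-- Pipe dreams: finite subsets of ℤ_{>0} × ℤ_{>0}, represented by lists
-- of crosses (r , c), considered up to set equality _≈_.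

PD : Set
PD = List (ℕ × ℕ)

ValidPD : PD → Set
ValidPD D = All (λ x → 1 ≤ Data.Product.proj₁ x × 1 ≤ Data.Product.proj₂ x) D

_≈_ : PD → PD → Set
D ≈ D' = ∀ x → (x ∈ D → x ∈ D') × (x ∈ D' → x ∈ D)

_∈PD_ : PD → List PD → Set
E ∈PD L = Any (λ F → E ≈ F) L

eqC : ℕ × ℕ → ℕ × ℕ → Bool
eqC (r , c) (r' , c') = (r ≡ᵇ r') ∧ (c ≡ᵇ c')

isIn : ℕ × ℕ → PD → Bool
isIn x D = any (eqC x) D

maxCoord : PD → ℕ
maxCoord = foldr (λ x m → Data.Product.proj₁ x ⊔ Data.Product.proj₂ x ⊔ m) 0

word : PD → List ℕ
word D = concatMap (λ r → concatMap
           (λ c → if isIn (r , c) D then (r + c ∸ 1) ∷ [] else [])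
           (reverse (range B))) (range B)
  where B = maxCoord D

𝒫 : (ℕ → ℕ) → PD → Set
𝒫 v D = ValidPD D × (∀ k → 1 ≤ k → demazure (word D) k ≡ v k)

start : ℕ → PD → ℕ
start i D = go (length D) 1
  where
  go : ℕ → ℕ → ℕ
  go zero j = j
  go (suc f) j = if isIn (i , j) D then go f (suc j) else j

𝒥 : ℕ → PD → List ℕ
𝒥 i D = filterᵇ (λ j → not (isIn (suc i , j) D)) (range (start i D ∸ 1))

Dp : ℕ → PD → ℕ → PD
Dp i D p = filterᵇ (λ x → not (removed x)) D ++ map (λ j → (suc i , j)) J<
  where
  J< : List ℕ
  J< = filterᵇ (λ j → j <ᵇ p) (𝒥 i D)
  removed : ℕ × ℕ → Bool
  removed x = eqC x (i , p) ∨ any (λ j → eqC x (i , j)) J<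

mitosis : ℕ → PD → List PD
mitosis i D = map (Dp i D) (𝒥 i D)

interleave : List PD → List PD
interleave [] = []
interleave (x ∷ []) = x ∷ []
interleave (x ∷ y ∷ r) = x ∷ (x ++ y) ∷ interleave (y ∷ r)

mitosis′ : ℕ → PD → List PD
mitosis′ i D = interleave (mitosis i D)

𝒫∅ : Perm → ℕ → PD → Set
𝒫∅ w i D = 𝒫 (fn w) D × mitosis i D ≡ []

𝒫s : Perm → ℕ → PD → Set
𝒫s w i D = 𝒫 (fn w) D × ¬ (mitosis i D ≡ []) × All (𝒫 (fn w ·s i)) (mitosis i D)

𝒫I : Perm → ℕ → PD → Set
𝒫I w i D = 𝒫 (fn w) D × ¬ (mitosis i D ≡ []) × All (𝒫 (fn w)) (mitosis i D)

{-# OPTIONS --safe #-}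

-- The Demazure product is computed by the sorting network that puts positions a and a + 1 in descending order
-- for each letter a. By commutation, rows i and i + 1 of a pipe dream may be read by columns from right to
-- left, and then a letter s_i multiplied on the right travels to the left through the columns. At a column
-- whose lower cell is a cross it moves on, after exchanging the contents (x, +) of the column for (+, x); at
-- the first column b whose lower cell is empty it is absorbed, filling the upper cell. So E · s_i is the product
-- of an explicit pipe dream D = Ψ(E), and mitosis′ of D consists of the E with Ψ(E) = D and mitosis E = ∅.
-- Hence the sets mitosis′(D) are disjoint. All E in mitosis′(D) have the same product: if the first gap a of
-- row i in E is not already b, the cross (i + 1, a) is itself a letter travelling to the left from column a + 1,
-- which turns E into D without the cross (i, a), and a is the first gap of row i + 1 in D.
module Submission where

open import Defs
open import Data.Bool using (Bool; true; false; T; if_then_else_; not; _∧_; _∨_)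
open import Data.Bool.ListAction using (any)
open import Data.Bool.Properties using (∧-identityʳ; ∧-zeroʳ; ∨-identityʳ; ∨-zeroʳ; ∨-assoc; ∨-idem; not-involutive)
open import Data.Empty using (⊥; ⊥-elim)
open import Data.List using (List; []; _∷_; _++_; map; concatMap; upTo; reverse; filterᵇ; length; foldl; foldr)
open import Data.List.Membership.Propositional using (_∈_)
open import Data.List.Membership.Propositional.Properties using (∈-∃++; ∈-++⁺ˡ; ∈-++⁺ʳ; ∈-++⁻)
open import Data.List.Properties
  using (concatMap-++; foldl-++; length-++; map-++; map-upTo; map-∘; unfold-reverse; upTo-∷ʳ; ++-identityʳ)
open import Data.List.Relation.Unary.All as All using (All; []; _∷_)
import Data.List.Relation.Unary.All.Properties as All
open import Data.List.Relation.Unary.AllPairs using (AllPairs; []; _∷_)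
import Data.List.Relation.Unary.AllPairs.Properties as AllPairs
open import Data.List.Relation.Unary.Any using (here; there)
open import Data.List.Relation.Unary.Any.Properties using (reverse⁻)
open import Data.Nat
open import Data.Nat.ListAction using (sum)
open import Data.Nat.ListAction.Properties using (sum-++)
open import Data.Nat.Properties
open import Data.Nat.Solver using (module +-*-Solver)
open import Data.Product using (_×_; _,_; proj₁; proj₂; Σ; ∃; ∃₂)
open import Data.Sum using (_⊎_; inj₁; inj₂; map₂)
open import Function using (_∘_; id)
open import Relation.Binary.Definitions using (tri<; tri≈; tri>)
open import Relation.Binary.PropositionalEquality
open import Relation.Nullary using (¬_; yes; no)
open import Relation.Nullary.Decidable using (dec-true; dec-false; T?)

-- Inversions

data Position (a : ℕ) : ℕ → Set where
  here  : Position a a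
  next  : Position a (suc a)
  apart : ∀ {k} → k ≢ a → k ≢ suc a → Position a k

position : ∀ a k → Position a k
position a k with k ≟ a | k ≟ suc a
... | yes refl | _        = here
... | no _     | yes refl = next
... | no p     | no q     = apart p q

-- By unfolding, `swap a k` is `atPair a (suc a) a k k`, and `sort` is defined in the same form, so
-- the three equations below serve both.
atPair : {A : Set} → ℕ → A → A → A → ℕ → A
atPair a x y z k = if k ≡ᵇ a then x else (if k ≡ᵇ suc a then y else z)

module _ {A : Set} (a : ℕ) {x y z : A} where
  atPair-here : atPair a x y z a ≡ x
  atPair-here rewrite dec-true (a ≟ a) refl = refl

  atPair-next : atPair a x y z (suc a) ≡ y
  atPair-next rewrite dec-false (suc a ≟ a) 1+n≢n | dec-true (a ≟ a) refl = refl

  atPair-apart : ∀ {k} → k ≢ a → k ≢ suc a → atPair a x y z k ≡ z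
  atPair-apart {k} p q rewrite dec-false (k ≟ a) p | dec-false (k ≟ suc a) q = refl

swap-involutive : ∀ a k → swap a (swap a k) ≡ k
swap-involutive a k with position a k
... | here      = trans (cong (swap a) (atPair-here a)) (atPair-next a)
... | next      = trans (cong (swap a) (atPair-next a)) (atPair-here a)
... | apart p q = trans (cong (swap a) (atPair-apart a p q)) (atPair-apart a p q)

swap-injective : ∀ a {k l} → swap a k ≡ swap a l → k ≡ l
swap-injective a {k} {l} e =
  trans (sym (swap-involutive a k)) (trans (cong (swap a) e) (swap-involutive a l))

Σ≤ : ℕ → (ℕ → ℕ) → ℕ
Σ≤ zero    f = 0
Σ≤ (suc n) f = Σ≤ n f + f (suc n)

sum-range : ∀ f n → sum (map f (range n)) ≡ Σ≤ n f
sum-range f zero    = refl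
sum-range f (suc n) = begin
  sum (map f (map suc (upTo (suc n))))             ≡⟨ cong (λ l → sum (map f (map suc l))) (upTo-∷ʳ n) ⟨
  sum (map f (map suc (upTo n ++ n ∷ [])))         ≡⟨ cong (sum ∘ map f) (map-++ suc (upTo n) _) ⟩
  sum (map f (range n ++ suc n ∷ []))              ≡⟨ cong sum (map-++ f (range n) _) ⟩
  sum (map f (range n) ++ f (suc n) ∷ [])          ≡⟨ sum-++ (map f (range n)) _ ⟩
  sum (map f (range n)) + (f (suc n) + 0)          ≡⟨ cong₂ _+_ (sum-range f n) (+-identityʳ _) ⟩
  Σ≤ n f + f (suc n)                               ∎
  where open ≡-Reasoning

Σ≤-cong : ∀ n {f g : ℕ → ℕ} → (∀ k → k ≤ n → f k ≡ g k) → Σ≤ n f ≡ Σ≤ n g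
Σ≤-cong zero    h = refl
Σ≤-cong (suc n) h = cong₂ _+_ (Σ≤-cong n λ k k≤n → h k (m≤n⇒m≤1+n k≤n)) (h (suc n) ≤-refl)

Σ≤-zero : ∀ n {f : ℕ → ℕ} → (∀ k → k ≤ n → f k ≡ 0) → Σ≤ n f ≡ 0
Σ≤-zero zero    h = refl
Σ≤-zero (suc n) h = cong₂ _+_ (Σ≤-zero n λ k k≤n → h k (m≤n⇒m≤1+n k≤n)) (h (suc n) ≤-refl)

Σ≤-+ : ∀ n f g → Σ≤ n (λ k → f k + g k) ≡ Σ≤ n f + Σ≤ n g
Σ≤-+ zero    f g = refl
Σ≤-+ (suc n) f g rewrite Σ≤-+ n f g =
  solve 4 (λ p q r s → (p :+ q) :+ (r :+ s) := (p :+ r) :+ (q :+ s)) refl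
    (Σ≤ n f) (Σ≤ n g) (f (suc n)) (g (suc n))
  where open +-*-Solver

Σ≤-single : ∀ n {f : ℕ → ℕ} a → 1 ≤ a → a ≤ n → (∀ k → k ≢ a → f k ≡ 0) → Σ≤ n f ≡ f a
Σ≤-single zero    a 1≤a a≤n h = ⊥-elim (<⇒≱ 1≤a a≤n)
Σ≤-single (suc n) {f} a 1≤a a≤n h with m≤n⇒m<n∨m≡n a≤n
... | inj₂ refl = cong (_+ f a) (Σ≤-zero n λ k k≤n → h k λ { refl → 1+n≰n k≤n })
... | inj₁ a<n  =
  trans (cong₂ _+_ (Σ≤-single n a 1≤a (s≤s⁻¹ a<n) h) (h (suc n) (≢-sym (<⇒≢ a<n)))) (+-identityʳ _)

-- Summands fixed by the exchange are peeled off the top until `suc a` is the top position; there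
-- the last two summands trade places.
Σ≤-swap : ∀ n f a → 1 ≤ a → a < n → Σ≤ n (f ∘ swap a) ≡ Σ≤ n f
Σ≤-swap (suc n) f a 1≤a (s≤s a≤n) with m≤n⇒m<n∨m≡n a≤n
... | inj₁ a<n  = cong₂ _+_ (Σ≤-swap n f a 1≤a a<n)
  (cong f (atPair-apart a (≢-sym (<⇒≢ (m<n⇒m<1+n a<n))) (≢-sym (<⇒≢ (s≤s a<n)))))
Σ≤-swap (suc (suc m)) f _ 1≤a (s≤s a≤n) | inj₂ refl = begin
  Σ≤ m (f ∘ swap a) + f (swap a a) + f (swap a (suc a))
    ≡⟨ cong₂ _+_ (cong₂ _+_ (Σ≤-cong m below) (cong f (atPair-here a))) (cong f (atPair-next a)) ⟩
  Σ≤ m f + f (suc a) + f a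
    ≡⟨ solve 3 (λ p q r → p :+ q :+ r := p :+ r :+ q) refl (Σ≤ m f) (f (suc a)) (f a) ⟩
  Σ≤ m f + f a + f (suc a) ∎
  where
  open ≡-Reasoning
  open +-*-Solver
  a = suc m
  below : ∀ k → k ≤ m → f (swap a k) ≡ f k
  below k k≤m = cong f (atPair-apart a (<⇒≢ (s≤s k≤m)) (<⇒≢ (m<n⇒m<1+n (s≤s k≤m))))

inversion : (ℕ → ℕ) → ℕ → ℕ → ℕ
inversion f x y = if (x <ᵇ y) ∧ (f y <ᵇ f x) then 1 else 0

inversions : ℕ → (ℕ → ℕ) → ℕ
inversions n f = Σ≤ n λ x → Σ≤ n (inversion f x)

len-inversions : ∀ n f → len n f ≡ inversions n f
len-inversions n f =
  trans (sum-range _ n) (Σ≤-cong n λ x _ → sum-range _ n)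

len-cong : ∀ n {f g} → f ≗ g → len n f ≡ len n g
len-cong n {f} {g} h = trans (len-inversions n f) (trans
  (Σ≤-cong n λ x _ → Σ≤-cong n λ y _ →
    cong₂ (λ p q → if (x <ᵇ y) ∧ (p <ᵇ q) then 1 else 0) (h y) (h x))
  (sym (len-inversions n g)))

<ᵇ-cong : ∀ {m n m′ n′} → (m < n → m′ < n′) → (m′ < n′ → m < n) → (m <ᵇ n) ≡ (m′ <ᵇ n′)
<ᵇ-cong {m} {n} {m′} {n′} f g with m <? n | m′ <? n′
... | yes p | yes q = trans (dec-true (m <? n) p) (sym (dec-true (m′ <? n′) q))
... | no p  | no q  = trans (dec-false (m <? n) p) (sym (dec-false (m′ <? n′) q))
... | yes p | no q  = ⊥-elim (q (f p))
... | no p  | yes q = ⊥-elim (p (g q))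

-- No integer lies strictly between `a` and `a + 1`, so exchanging the two affects no comparison
-- except the one between them.
swap-<ᵇ : ∀ a x y → ¬ (x ≡ a × y ≡ suc a) → ¬ (x ≡ suc a × y ≡ a) →
  (swap a x <ᵇ swap a y) ≡ (x <ᵇ y)
swap-<ᵇ a x y h h′ with position a x | position a y
... | here | next = ⊥-elim (h (refl , refl))
... | next | here = ⊥-elim (h′ (refl , refl))
... | here | here rewrite atPair-here a {suc a} {a} {a} =
  <ᵇ-cong {suc a} {suc a} {a} {a} (λ p → ⊥-elim (<-irrefl refl p)) (λ p → ⊥-elim (<-irrefl refl p))
... | next | next rewrite atPair-next a {suc a} {a} {suc a} =
  <ᵇ-cong {a} {a} {a} {a} (λ p → ⊥-elim (<-irrefl refl p)) (λ p → ⊥-elim (<-irrefl refl p))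
... | here | apart p q rewrite atPair-here a {suc a} {a} {a} | atPair-apart a {suc a} {a} {y} p q =
  <ᵇ-cong <⇒≤ (λ l → ≤∧≢⇒< l (≢-sym q))
... | next | apart p q rewrite atPair-next a {suc a} {a} {suc a} | atPair-apart a {suc a} {a} {y} p q =
  <ᵇ-cong (λ l → ≤∧≢⇒< l (≢-sym q)) <⇒≤
... | apart p q | here rewrite atPair-here a {suc a} {a} {a} | atPair-apart a {suc a} {a} {x} p q =
  <ᵇ-cong (λ l → ≤∧≢⇒< (s≤s⁻¹ l) p) m<n⇒m<1+n
... | apart p q | next rewrite atPair-next a {suc a} {a} {suc a} | atPair-apart a {suc a} {a} {x} p q =
  <ᵇ-cong m<n⇒m<1+n (λ l → ≤∧≢⇒< (s≤s⁻¹ l) p)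
... | apart p q | apart p′ q′ rewrite atPair-apart a {suc a} {a} {x} p q | atPair-apart a {suc a} {a} {y} p′ q′ = refl

δ : ℕ → ℕ → ℕ
δ a k = if k ≡ᵇ a then 1 else 0

δ-refl : ∀ a → δ a a ≡ 1
δ-refl a rewrite dec-true (a ≟ a) refl = refl

δ-≢ : ∀ {a k} → k ≢ a → δ a k ≡ 0
δ-≢ {a} {k} p rewrite dec-false (k ≟ a) p = refl

-- Only the pair (a, a + 1) changes sides; it is counted at (x , y) = (a + 1 , a).
inversion-swap : ∀ u a → u a < u (suc a) → ∀ x y →
  inversion (u ·s a) (swap a x) (swap a y) ≡ inversion u x y + δ (suc a) x * δ a y
inversion-swap u a asc x y
  rewrite swap-involutive a x | swap-involutive a y
  with x ≟ a | x ≟ suc a | y ≟ a | y ≟ suc a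
... | yes refl | _ | _ | yes refl
  rewrite dec-false (u (suc a) <? u a) (<⇒≯ asc) | δ-≢ (≢-sym (1+n≢n {a}))
  | ∧-zeroʳ (swap a a <ᵇ swap a (suc a)) | ∧-zeroʳ (a <ᵇ suc a) = refl
... | _ | yes refl | yes refl | _
  rewrite δ-refl a | atPair-next a {suc a} {a} {suc a} | atPair-here a {suc a} {a} {a}
  | dec-true (u a <? u (suc a)) asc | dec-true (a <? suc a) ≤-refl
  | dec-false (suc a <? a) (λ l → 1+n≰n (<⇒≤ l)) = refl
... | no p | no q | _ | _
  rewrite swap-<ᵇ a x y (p ∘ proj₁) (q ∘ proj₁) | δ-≢ q = sym (+-identityʳ _)
... | _ | _ | no p | no q
  rewrite swap-<ᵇ a x y (q ∘ proj₂) (p ∘ proj₂) | δ-≢ p | *-zeroʳ (δ (suc a) x) = sym (+-identityʳ _)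
... | yes refl | _ | yes refl | no q
  rewrite swap-<ᵇ a x y (q ∘ proj₂) (λ e → 1+n≢n (sym (proj₁ e))) | δ-≢ (≢-sym (1+n≢n {a})) = sym (+-identityʳ _)
... | no p | yes refl | no q | yes refl
  rewrite swap-<ᵇ a x y (p ∘ proj₁) (q ∘ proj₂) | δ-≢ q | *-zeroʳ (δ (suc a) (suc a)) = sym (+-identityʳ _)

-- Reindexing both sums by `swap a` turns the inversions of `u ·s a` into those of `u` plus a
-- correction supported on a single pair, hence of total 1.
inversions-ascent : ∀ n u a → 1 ≤ a → a < n → u a < u (suc a) →
  inversions n (u ·s a) ≡ suc (inversions n u)
inversions-ascent n u a 1≤a a<n asc = begin
  Σ≤ n (λ x → Σ≤ n (inversion v x))
    ≡⟨ Σ≤-swap n _ a 1≤a a<n ⟨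
  Σ≤ n (λ x → Σ≤ n (inversion v (swap a x)))
    ≡⟨ Σ≤-cong n (λ x _ → Σ≤-swap n _ a 1≤a a<n) ⟨
  Σ≤ n (λ x → Σ≤ n (λ y → inversion v (swap a x) (swap a y)))
    ≡⟨ Σ≤-cong n (λ x _ → Σ≤-cong n λ y _ → inversion-swap u a asc x y) ⟩
  Σ≤ n (λ x → Σ≤ n (λ y → inversion u x y + δ (suc a) x * δ a y))
    ≡⟨ Σ≤-cong n (λ x _ → Σ≤-+ n _ _) ⟩
  Σ≤ n (λ x → Σ≤ n (inversion u x) + Σ≤ n (λ y → δ (suc a) x * δ a y))
    ≡⟨ Σ≤-+ n _ _ ⟩
  inversions n u + Σ≤ n (λ x → Σ≤ n (λ y → δ (suc a) x * δ a y))
    ≡⟨ cong (inversions n u +_) one ⟩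
  inversions n u + 1
    ≡⟨ +-comm _ 1 ⟩
  suc (inversions n u) ∎
  where
  open ≡-Reasoning
  v = u ·s a
  one : Σ≤ n (λ x → Σ≤ n (λ y → δ (suc a) x * δ a y)) ≡ 1
  one = trans
    (Σ≤-single n (suc a) (s≤s z≤n) a<n λ x x≢ → Σ≤-zero n λ y _ → cong (_* δ a y) (δ-≢ x≢))
    (trans (Σ≤-single n a 1≤a (<⇒≤ a<n) λ y y≢ →
              trans (cong (δ (suc a) (suc a) *_) (δ-≢ y≢)) (*-zeroʳ (δ (suc a) (suc a))))
           (cong₂ _*_ (δ-refl (suc a)) (δ-refl a)))

len-ascent : ∀ n u a → 1 ≤ a → a < n → u a < u (suc a) → len n (u ·s a) ≡ suc (len n u)
len-ascent n u a 1≤a a<n asc = trans (len-inversions n (u ·s a))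
  (trans (inversions-ascent n u a 1≤a a<n asc) (cong suc (sym (len-inversions n u))))

-- This is the ascent case for `u ·s a`: a second multiplication by s_a gives back `u`.
len-descent : ∀ n u a → 1 ≤ a → a < n → u (suc a) < u a → len n u ≡ suc (len n (u ·s a))
len-descent n u a 1≤a a<n desc = trans
  (len-cong n λ k → cong u (sym (swap-involutive a k)))
  (len-ascent n (u ·s a) a 1≤a a<n
    (subst₂ _<_ (cong u (sym (atPair-here a))) (cong u (sym (atPair-next a))) desc))

inversions-fixed : ∀ n f → f (suc n) ≡ suc n → (∀ k → k ≤ n → f k ≤ n) →
  inversions (suc n) f ≡ inversions n f
inversions-fixed n f fix below = begin
  Σ≤ n (λ x → Σ≤ n (inversion f x) + inversion f x (suc n)) + Σ≤ (suc n) (inversion f (suc n))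
    ≡⟨ cong₂ _+_ (Σ≤-cong n λ x x≤n → trans (cong (Σ≤ n (inversion f x) +_) (last x x≤n)) (+-identityʳ _))
                 (Σ≤-zero (suc n) λ y y≤n → first y y≤n) ⟩
  inversions n f + 0  ≡⟨ +-identityʳ _ ⟩
  inversions n f ∎
  where
  open ≡-Reasoning
  last : ∀ x → x ≤ n → inversion f x (suc n) ≡ 0
  last x x≤n rewrite fix
    | dec-false (suc n <? f x) (λ l → 1+n≰n (≤-trans (<⇒≤ l) (below x x≤n)))
    | ∧-zeroʳ (x <ᵇ suc n) = refl
  first : ∀ y → y ≤ suc n → inversion f (suc n) y ≡ 0
  first y y≤n rewrite dec-false (suc n <? y) (≤⇒≯ y≤n) = refl

-- A value `fn w k` above `n` would be a fixed point of `w`, so by injectivity it would equal `k`,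
-- which is at most `n`.
fn-≤ : ∀ w n → bound w ≤ n → ∀ k → k ≤ n → fn w k ≤ n
fn-≤ w n b≤n k k≤n with fn w k ≤? n
... | yes p = p
... | no p  = subst (_≤ n)
  (sym (fn-inj w (fn w k) k (fn-fix w (fn w k) (≤-<-trans b≤n (≰⇒> p))))) k≤n

len-stable : ∀ w n m → bound w ≤ n → len (m + n) (fn w) ≡ len n (fn w)
len-stable w n zero    b≤n = refl
len-stable w n (suc m) b≤n = begin
  len (suc (m + n)) (fn w)        ≡⟨ len-inversions (suc (m + n)) (fn w) ⟩
  inversions (suc (m + n)) (fn w) ≡⟨ inversions-fixed (m + n) (fn w)
                                       (fn-fix w _ (s≤s b≤)) (fn-≤ w (m + n) b≤) ⟩
  inversions (m + n) (fn w)       ≡⟨ len-inversions (m + n) (fn w) ⟨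
  len (m + n) (fn w)              ≡⟨ len-stable w n m b≤n ⟩
  len n (fn w)                    ∎
  where
  open ≡-Reasoning
  b≤ : bound w ≤ m + n
  b≤ = ≤-trans b≤n (m≤n+m n m)

-- The two lengths are counted over different ranges; `len-stable` moves `ℓ w` to the larger one.
-- There an ascent would raise the length by one, giving `ℓ w + 2 = ℓ w`.
ℓ-descent : ∀ w i → 1 ≤ i → ℓ·s w i + 1 ≡ ℓ w → fn w (suc i) < fn w i
ℓ-descent w i 1≤i e with <-cmp (fn w i) (fn w (suc i))
... | tri> _ _ desc = desc
... | tri≈ _ eq _   = ⊥-elim (1+n≢n (sym (fn-inj w _ _ eq)))
... | tri< asc _ _  = ⊥-elim (1+n≰n (≤-trans (s≤s (n≤1+n _)) (≤-reflexive contra)))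
  where
  open ≡-Reasoning
  n = bound w ⊔ suc i
  stable : len n (fn w) ≡ ℓ w
  stable = subst (λ m → len m (fn w) ≡ ℓ w) (m∸n+n≡m (m≤m⊔n (bound w) (suc i)))
    (len-stable w (bound w) (n ∸ bound w) ≤-refl)
  contra : suc (suc (ℓ w)) ≡ ℓ w
  contra = begin
    suc (suc (ℓ w))           ≡⟨ cong (suc ∘ suc) stable ⟨
    suc (suc (len n (fn w)))  ≡⟨ cong suc (len-ascent n (fn w) i 1≤i (m≤n⊔m (bound w) (suc i)) asc) ⟨
    suc (ℓ·s w i)             ≡⟨ +-comm _ 1 ⟨
    ℓ·s w i + 1               ≡⟨ e ⟩
    ℓ w                       ∎

-- Sorting operators

-- One step of the Demazure product in one-line notation, free of any length test: an ascending pair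
-- is exchanged, a descending pair is kept.
sort : ℕ → (ℕ → ℕ) → ℕ → ℕ
sort a u k = atPair a (u a ⊔ u (suc a)) (u a ⊓ u (suc a)) (u k) k

sort-ascent : ∀ a u → u a ≤ u (suc a) → sort a u ≗ u ·s a
sort-ascent a u asc k with position a k
... | here = trans (atPair-here a) (trans (m≤n⇒m⊔n≡n asc) (cong u (sym (atPair-here a))))
... | next = trans (atPair-next a) (trans (m≤n⇒m⊓n≡m asc) (cong u (sym (atPair-next a))))
... | apart p q = trans (atPair-apart a p q) (cong u (sym (atPair-apart a p q)))

sort-descent : ∀ a u → u (suc a) ≤ u a → sort a u ≗ u
sort-descent a u desc k with position a k
... | here = trans (atPair-here a) (m≥n⇒m⊔n≡m desc)
... | next = trans (atPair-next a) (m≥n⇒m⊓n≡n desc)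
... | apart p q = atPair-apart a p q

sort-sorts : ∀ a u → sort a u (suc a) ≤ sort a u a
sort-sorts a u rewrite atPair-next a {u a ⊔ u (suc a)} {u a ⊓ u (suc a)} {u (suc a)}
  | atPair-here a {u a ⊔ u (suc a)} {u a ⊓ u (suc a)} {u a} = m⊓n≤m⊔n (u a) (u (suc a))

Op : Set
Op = (ℕ → ℕ) → ℕ → ℕ

infix 4 _≋_
-- Functions are compared only pointwise, so equality of operators includes compatibility with
-- pointwise equality. In particular `f ≋ f` has content, which the `-cong` lemmas provide.
_≋_ : Op → Op → Set
f ≋ g = ∀ {u v} → u ≗ v → f u ≗ g v

sort-cong : ∀ a → sort a ≋ sort a
sort-cong a {u} {v} h k rewrite h a | h (suc a) | h k = refl

act : List ℕ → Op
act w u = foldl (λ v a → sort a v) u w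

Injective : (ℕ → ℕ) → Set
Injective u = ∀ {k l} → u k ≡ u l → k ≡ l

-- By `len-ascent` and `len-descent` the length test succeeds exactly at an ascent, which is when
-- `sort` exchanges; injectivity excludes ties.
demazureGo-act : ∀ n {u v} w → All (λ a → 1 ≤ a × a < n) w → Injective u → u ≗ v →
  demazureGo n u w ≗ act w v
demazureGo-act n [] [] inj h = h
demazureGo-act n {u} (a ∷ w) ((1≤a , a<n) ∷ ps) inj h with <-cmp (u a) (u (suc a))
... | tri≈ _ eq _ = ⊥-elim (1+n≢n (sym (inj eq)))
... | tri< asc _ _
  rewrite dec-true (len n (u ·s a) ≟ suc (len n u)) (len-ascent n u a 1≤a a<n asc) =
  demazureGo-act n w ps (swap-injective a ∘ inj)
    λ k → trans (sym (sort-ascent a u (<⇒≤ asc) k)) (sort-cong a h k)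
... | tri> _ _ desc
  rewrite dec-false (len n (u ·s a) ≟ suc (len n u))
    (λ e → 1+n≰n (≤-trans (n≤1+n _) (≤-reflexive (trans (cong suc (sym e)) (sym (len-descent n u a 1≤a a<n desc)))))) =
  demazureGo-act n w ps inj
    λ k → trans (sym (sort-descent a u (<⇒≤ desc) k)) (sort-cong a h k)

∈-≤maxList : ∀ w → All (λ a → a ≤ maxList w) w
∈-≤maxList w = go w ≤-refl
  where
  go : ∀ v {m} → maxList v ≤ m → All (λ a → a ≤ m) v
  go []      h = []
  go (a ∷ v) h = ≤-trans (m≤m⊔n a _) h ∷ go v (≤-trans (m≤n⊔m a _) h)

demazure-act : ∀ w → All (1 ≤_) w → demazure w ≗ act w id
demazure-act w ps = demazureGo-act _ w (both ps (∈-≤maxList w)) id λ _ → refl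
  where
  both : ∀ {m v} → All (1 ≤_) v → All (λ a → a ≤ m) v → All (λ a → 1 ≤ a × a < suc m) v
  both []       []       = []
  both (p ∷ ps) (q ∷ qs) = (p , s≤s q) ∷ both ps qs

-- Relations between sorting operators

infixr 5 _⨾_
_⨾_ : Op → Op → Op
(f ⨾ g) u = g (f u)

infixr 2 _⟫_
_⟫_ : ∀ {f g h} → f ≋ g → g ≋ h → f ≋ h
(p ⟫ q) e k = trans (p e k) (q (λ _ → refl) k)

≋-sym : ∀ {f g} → f ≋ g → g ≋ f
≋-sym p e k = sym (p (λ l → sym (e l)) k)

⨾-cong : ∀ {f f′ g g′} → f ≋ f′ → g ≋ g′ → (f ⨾ g) ≋ (f′ ⨾ g′)
⨾-cong p q e = q (p e)

id-cong : id ≋ id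
id-cong e = e

pointwise : ∀ {f g} → g ≋ g → (∀ u → f u ≗ g u) → f ≋ g
pointwise p h {u} e k = trans (h u k) (p e k)

module _ (a : ℕ) (u : ℕ → ℕ) where
  sort-here : sort a u a ≡ u a ⊔ u (suc a)
  sort-here = atPair-here a

  sort-next : sort a u (suc a) ≡ u a ⊓ u (suc a)
  sort-next = atPair-next a

  sort-apart : ∀ {k} → k ≢ a → k ≢ suc a → sort a u k ≡ u k
  sort-apart = atPair-apart a

sort-idem : ∀ a → (sort a ⨾ sort a) ≋ sort a
sort-idem a = pointwise (sort-cong a) λ u → sort-descent a (sort a u) (sort-sorts a u)

sort-comm : ∀ a b → suc a < b → (sort a ⨾ sort b) ≋ (sort b ⨾ sort a)
sort-comm a b a+1<b = pointwise (⨾-cong (sort-cong b) (sort-cong a)) eq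
  where
  a<b : a < b
  a<b = <⇒≤ a+1<b
  a≢b = <⇒≢ a<b
  a≢b+1 = <⇒≢ (m<n⇒m<1+n a<b)
  a+1≢b = <⇒≢ a+1<b
  a+1≢b+1 = <⇒≢ (m<n⇒m<1+n a+1<b)
  eq : ∀ u → sort b (sort a u) ≗ sort a (sort b u)
  eq u k with position a k | position b k
  ... | here | here = ⊥-elim (<-irrefl refl a<b)
  ... | here | next = ⊥-elim (<-irrefl refl (≤-trans (n≤1+n _) a<b))
  ... | next | here = ⊥-elim (a+1≢b refl)
  ... | next | next = ⊥-elim (a≢b refl)
  ... | here | apart p q = trans (sort-apart b (sort a u) p q) (trans (sort-here a u)
    (sym (trans (sort-here a (sort b u)) (cong₂ _⊔_ (sort-apart b u a≢b a≢b+1) (sort-apart b u a+1≢b a+1≢b+1)))))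
  ... | next | apart p q = trans (sort-apart b (sort a u) p q) (trans (sort-next a u)
    (sym (trans (sort-next a (sort b u)) (cong₂ _⊓_ (sort-apart b u a≢b a≢b+1) (sort-apart b u a+1≢b a+1≢b+1)))))
  ... | apart p q | here = trans (trans (sort-here b (sort a u)) (cong₂ _⊔_
      (sort-apart a u (≢-sym a≢b) (≢-sym a+1≢b)) (sort-apart a u (≢-sym a≢b+1) (≢-sym a+1≢b+1))))
    (sym (trans (sort-apart a (sort b u) p q) (sort-here b u)))
  ... | apart p q | next = trans (trans (sort-next b (sort a u)) (cong₂ _⊓_
      (sort-apart a u (≢-sym a≢b) (≢-sym a+1≢b)) (sort-apart a u (≢-sym a≢b+1) (≢-sym a+1≢b+1))))
    (sym (trans (sort-apart a (sort b u) p q) (sort-next b u)))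
  ... | apart p q | apart p′ q′ = trans (sort-apart b (sort a u) p′ q′) (trans (sort-apart a u p q)
    (sym (trans (sort-apart a (sort b u) p q) (sort-apart b u p′ q′))))

module _ (x y z : ℕ) where
  open ≡-Reasoning

  -- With `x`, `y`, `z` at three consecutive positions, each of these identities equates one output
  -- of the two sides of the braid relation.
  max-of-three : (x ⊔ y) ⊔ ((x ⊓ y) ⊔ z) ≡ x ⊔ (y ⊔ z)
  max-of-three = begin
    (x ⊔ y) ⊔ ((x ⊓ y) ⊔ z)  ≡⟨ ⊔-assoc (x ⊔ y) (x ⊓ y) z ⟨
    ((x ⊔ y) ⊔ (x ⊓ y)) ⊔ z  ≡⟨ cong (_⊔ z) (m≥n⇒m⊔n≡m (m⊓n≤m⊔n x y)) ⟩
    (x ⊔ y) ⊔ z              ≡⟨ ⊔-assoc x y z ⟩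
    x ⊔ (y ⊔ z)              ∎

  min-of-three : (x ⊓ y) ⊓ z ≡ (x ⊓ (y ⊔ z)) ⊓ (y ⊓ z)
  min-of-three = begin
    (x ⊓ y) ⊓ z              ≡⟨ ⊓-assoc x y z ⟩
    x ⊓ (y ⊓ z)              ≡⟨ cong (x ⊓_) (m≥n⇒m⊓n≡n (m⊓n≤m⊔n y z)) ⟨
    x ⊓ ((y ⊔ z) ⊓ (y ⊓ z))  ≡⟨ ⊓-assoc x (y ⊔ z) (y ⊓ z) ⟨
    (x ⊓ (y ⊔ z)) ⊓ (y ⊓ z)  ∎

  median-of-three : (x ⊔ y) ⊓ ((x ⊓ y) ⊔ z) ≡ (x ⊓ (y ⊔ z)) ⊔ (y ⊓ z)
  median-of-three = begin
    (x ⊔ y) ⊓ ((x ⊓ y) ⊔ z)                ≡⟨ ⊓-distribˡ-⊔ (x ⊔ y) (x ⊓ y) z ⟩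
    ((x ⊔ y) ⊓ (x ⊓ y)) ⊔ ((x ⊔ y) ⊓ z)    ≡⟨ cong₂ _⊔_ (m≥n⇒m⊓n≡n (m⊓n≤m⊔n x y)) (⊓-distribʳ-⊔ z x y) ⟩
    (x ⊓ y) ⊔ ((x ⊓ z) ⊔ (y ⊓ z))          ≡⟨ ⊔-assoc (x ⊓ y) (x ⊓ z) (y ⊓ z) ⟨
    ((x ⊓ y) ⊔ (x ⊓ z)) ⊔ (y ⊓ z)          ≡⟨ cong (_⊔ (y ⊓ z)) (⊓-distribˡ-⊔ x y z) ⟨
    (x ⊓ (y ⊔ z)) ⊔ (y ⊓ z)                ∎

-- Both sides are sorting networks on three positions: each leaves the maximum, the median and the
-- minimum in this order.
sort-braid : ∀ a → (sort a ⨾ sort (suc a) ⨾ sort a) ≋ (sort (suc a) ⨾ sort a ⨾ sort (suc a))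
sort-braid a = pointwise (⨾-cong (sort-cong b) (⨾-cong (sort-cong a) (sort-cong b))) eq
  where
  b = suc a
  c = suc b
  a≢b : a ≢ b
  a≢b = ≢-sym 1+n≢n
  b≢c : b ≢ c
  b≢c = ≢-sym 1+n≢n
  a≢c : a ≢ c
  a≢c = <⇒≢ (n<1+n _ ⟨<⟩ n<1+n _)
    where _⟨<⟩_ = <-trans
  eq : ∀ u → sort a (sort b (sort a u)) ≗ sort b (sort a (sort b u))
  eq u = pick
    where
    s = sort a u
    v = sort b s
    t = sort b u
    w = sort a t
    va : v a ≡ u a ⊔ u b
    va = trans (sort-apart b s a≢b a≢c) (sort-here a u)
    vb : v b ≡ (u a ⊓ u b) ⊔ u c
    vb = trans (sort-here b s) (cong₂ _⊔_ (sort-next a u) (sort-apart a u (≢-sym a≢c) (≢-sym b≢c)))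
    vc : v c ≡ (u a ⊓ u b) ⊓ u c
    vc = trans (sort-next b s) (cong₂ _⊓_ (sort-next a u) (sort-apart a u (≢-sym a≢c) (≢-sym b≢c)))
    wa : w a ≡ u a ⊔ (u b ⊔ u c)
    wa = trans (sort-here a t) (cong₂ _⊔_ (sort-apart b u a≢b a≢c) (sort-here b u))
    wb : w b ≡ u a ⊓ (u b ⊔ u c)
    wb = trans (sort-next a t) (cong₂ _⊓_ (sort-apart b u a≢b a≢c) (sort-here b u))
    wc : w c ≡ u b ⊓ u c
    wc = trans (sort-apart a t (≢-sym a≢c) (≢-sym b≢c)) (sort-next b u)
    pick : sort a v ≗ sort b w
    pick k with position a k | position b k
    ... | here | _ = trans (trans (sort-here a v) (cong₂ _⊔_ va vb))
      (trans (max-of-three (u a) (u b) (u c)) (sym (trans (sort-apart b w a≢b a≢c) wa)))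
    ... | next | _ = trans (trans (sort-next a v) (cong₂ _⊓_ va vb))
      (trans (median-of-three (u a) (u b) (u c)) (sym (trans (sort-here b w) (cong₂ _⊔_ wb wc))))
    ... | apart p q | next = trans (trans (sort-apart a v p q) vc)
      (trans (min-of-three (u a) (u b) (u c)) (sym (trans (sort-next b w) (cong₂ _⊓_ wb wc))))
    ... | apart p q | here = ⊥-elim (q refl)
    ... | apart p q | apart p′ q′ = begin
      sort a v k  ≡⟨ sort-apart a v p q ⟩
      v k         ≡⟨ sort-apart b s p′ q′ ⟩
      s k         ≡⟨ sort-apart a u p q ⟩
      u k         ≡⟨ sort-apart b u p′ q′ ⟨
      t k         ≡⟨ sort-apart a t p q ⟨
      w k         ≡⟨ sort-apart b w p′ q′ ⟨
      sort b w k  ∎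
      where open ≡-Reasoning

-- Products of rows and columns of crosses

Cells : Set
Cells = ℕ → ℕ → Bool

when : Bool → ℕ → Op
when b a = if b then sort a else id

when-cong : ∀ b a → when b a ≋ when b a
when-cong true  a = sort-cong a
when-cong false a = id-cong

when-comm : ∀ b b′ a a′ → suc a < a′ → (when b a ⨾ when b′ a′) ≋ (when b′ a′ ⨾ when b a)
when-comm true  true  a a′ l = sort-comm a a′ l
when-comm true  false a a′ l = sort-cong a
when-comm false b′    a a′ l = when-cong b′ a′

cell : Cells → ℕ → ℕ → Op
cell P r c = when (P r c) (r + c ∸ 1)

-- Covers the columns `c`, ..., `c + n - 1`. As `⨾` applies its left factor first, the rightmost
-- cell acts first, as in the reading order of the word.
row : Cells → ℕ → ℕ → ℕ → Op
row P r c zero    = id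
row P r c (suc n) = row P r (suc c) n ⨾ cell P r c

rows : Cells → ℕ → ℕ → ℕ → Op
rows P C r zero    = id
rows P C r (suc n) = row P r 1 C ⨾ rows P C (suc r) n

cell-≡ : ∀ P Q r c → P r c ≡ Q r c → cell P r c ≋ cell Q r c
cell-≡ P Q r c e rewrite e = when-cong (Q r c) (r + c ∸ 1)

row-≡ : ∀ P Q r c n → (∀ x → c ≤ x → P r x ≡ Q r x) → row P r c n ≋ row Q r c n
row-≡ P Q r c zero    h = id-cong
row-≡ P Q r c (suc n) h =
  ⨾-cong (row-≡ P Q r (suc c) n λ x l → h x (<⇒≤ l)) (cell-≡ P Q r c (h c ≤-refl))

row-cong : ∀ P r c n → row P r c n ≋ row P r c n
row-cong P r c n = row-≡ P P r c n λ _ _ → refl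

row-empty : ∀ P r c n → (∀ x → c ≤ x → P r x ≡ false) → row P r c n ≋ id
row-empty P r c zero    h = id-cong
row-empty P r c (suc n) h rewrite h c ≤-refl = row-empty P r (suc c) n λ x l → h x (<⇒≤ l)

row-extend : ∀ P r c m n → (∀ x → c + m ≤ x → P r x ≡ false) → row P r c (m + n) ≋ row P r c m
row-extend P r c zero    n h = row-empty P r c n λ x l → h x (subst (_≤ x) (sym (+-identityʳ c)) l)
row-extend P r c (suc m) n h =
  ⨾-cong (row-extend P r (suc c) m n λ x l → h x (subst (_≤ x) (sym (+-suc c m)) l)) (when-cong (P r c) _)

rows-≋ : ∀ P Q C C′ r n → (∀ x → r ≤ x → x < r + n → row P x 1 C ≋ row Q x 1 C′) →
  rows P C r n ≋ rows Q C′ r n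
rows-≋ P Q C C′ r zero    h = id-cong
rows-≋ P Q C C′ r (suc n) h = ⨾-cong (h r ≤-refl (m<m+n r (s≤s z≤n)))
  (rows-≋ P Q C C′ (suc r) n λ x l l′ → h x (<⇒≤ l) (subst (x <_) (sym (+-suc r n)) l′))

rows-cong : ∀ P C r n → rows P C r n ≋ rows P C r n
rows-cong P C r n = rows-≋ P P C C r n λ x _ _ → row-cong P x 1 C

rows-empty : ∀ P C r n → (∀ x → r ≤ x → ∀ c → P x c ≡ false) → rows P C r n ≋ id
rows-empty P C r zero    h = id-cong
rows-empty P C r (suc n) h =
  ⨾-cong (row-empty P r 1 C λ c _ → h r ≤-refl c) (rows-empty P C (suc r) n λ x l → h x (<⇒≤ l))

rows-++ : ∀ P C r m n → rows P C r (m + n) ≡ (rows P C r m ⨾ rows P C (m + r) n)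
rows-++ P C r zero    n = refl
rows-++ P C r (suc m) n rewrite sym (+-suc m r) = cong (row P r 1 C ⨾_) (rows-++ P C (suc r) m n)

-- The word of a pipe dream scans a square whose size depends on the pipe dream; this makes it
-- possible to read two pipe dreams in one common square.
rows-extend : ∀ P M B → M ≤ B → (∀ r c → M < r ⊎ M < c → P r c ≡ false) →
  rows P B 1 B ≋ rows P M 1 M
rows-extend P M B M≤B h with m≤n⇒∃[o]m+o≡n M≤B
... | n , refl =
  rows-≋ P P (M + n) M 1 (M + n) (λ x _ _ → row-extend P x 1 M n λ c l → h x c (inj₂ l)) ⟫ split
  where
  split : rows P M 1 (M + n) ≋ rows P M 1 M
  split rewrite rows-++ P M 1 M n =
    ⨾-cong (rows-cong P M 1 M)
      (rows-empty P M (M + 1) n λ x l c → h x c (inj₁ (subst (_≤ x) (+-comm M 1) l)))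

-- The smallest letter available in this stretch of the row is `r + c ∸ 1`, so a letter at least 2
-- below it commutes with every cell.
row-after : ∀ P r c n b a → suc a < r + c ∸ 1 → (when b a ⨾ row P r c n) ≋ (row P r c n ⨾ when b a)
row-after P r c zero    b a l = when-cong b a
row-after P r c (suc n) b a l =
  ⨾-cong (row-after P r (suc c) n b a (≤-trans l (∸-monoˡ-≤ 1 (+-monoʳ-≤ r (n≤1+n c))))) (when-cong (P r c) _)
  ⟫ ⨾-cong (row-cong P r (suc c) n) (when-comm b (P r c) a _ l)

-- Row `r` starts in column 1 and therefore with the letter `r`; all letters from this row on exceed
-- `a + 1`.
rows-after : ∀ P C r n a → suc a < r → (sort a ⨾ rows P C r n) ≋ (rows P C r n ⨾ sort a)
rows-after P C r zero    a l = sort-cong a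
rows-after P C r (suc n) a l =
  ⨾-cong (row-after P r 1 C true a (subst (suc a <_) (sym (m+n∸n≡m r 1)) l)) (rows-cong P C (suc r) n)
  ⟫ ⨾-cong (row-cong P r 1 C) (rows-after P C (suc r) n a (m<n⇒m<1+n l))

-- The specification of `start` for a row given as a Boolean function. Since it has at most one
-- solution, gaps of different pipe dreams are identified without computing them.
FirstGap : (ℕ → Bool) → ℕ → Set
FirstGap p a = 1 ≤ a × (∀ c → 1 ≤ c → c < a → p c ≡ true) × p a ≡ false

FirstGap-unique : ∀ {p a b} → FirstGap p a → FirstGap p b → a ≡ b
FirstGap-unique {a = a} {b} (1≤a , full , gap) (1≤b , full′ , gap′) with <-cmp a b
... | tri< a<b _ _ with () ← trans (sym gap) (full′ a 1≤a a<b)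
... | tri≈ _ e _ = e
... | tri> _ _ b<a with () ← trans (sym gap′) (full b 1≤b b<a)

-- Two adjacent rows read by columns

module _ (k : ℕ) where
  -- With i = k + 1, the cells (i, c) and (i + 1, c) carry the letters k + c and k + c + 1; working
  -- with `k` avoids the truncated subtraction.
  column : Cells → ℕ → Op
  column P c = when (P (suc k) c) (k + c) ⨾ when (P (suc (suc k)) c) (suc (k + c))

  columns : Cells → ℕ → ℕ → Op
  columns P c zero    = id
  columns P c (suc n) = columns P (suc c) n ⨾ column P c

  SameColumn : Cells → Cells → ℕ → Set
  SameColumn P Q c = P (suc k) c ≡ Q (suc k) c × P (suc (suc k)) c ≡ Q (suc (suc k)) c

  column-≡ : ∀ P Q c → SameColumn P Q c → column P c ≋ column Q c
  column-≡ P Q c (e , e′) rewrite e | e′ = ⨾-cong (when-cong (Q (suc k) c) _) (when-cong (Q (suc (suc k)) c) _)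

  columns-≡ : ∀ P Q c n → (∀ x → c ≤ x → SameColumn P Q x) → columns P c n ≋ columns Q c n
  columns-≡ P Q c zero    h = id-cong
  columns-≡ P Q c (suc n) h =
    ⨾-cong (columns-≡ P Q (suc c) n λ x l → h x (<⇒≤ l)) (column-≡ P Q c (h c ≤-refl))

  -- A cross (k + 1, c) commutes with every cross (k + 2, c′), c′ > c.
  rows-columns : ∀ P c n → (row P (suc k) c n ⨾ row P (suc (suc k)) c n) ≋ columns P c n
  rows-columns P c zero    = id-cong
  rows-columns P c (suc n) =
    ⨾-cong (row-cong P (suc k) (suc c) n)
      (⨾-cong (row-after P (suc (suc k)) (suc c) n (P (suc k) c) (k + c) (s≤s (≤-reflexive (sym (+-suc k c)))))
        (when-cong (P (suc (suc k)) c) _))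
    ⟫ ⨾-cong (rows-columns P (suc c) n) (⨾-cong (when-cong (P (suc k) c) _) (when-cong (P (suc (suc k)) c) _))

  rows-split : ∀ P C m → rows P C 1 (k + suc (suc m)) ≋
    (rows P C 1 k ⨾ columns P 1 C ⨾ rows P C (suc (suc (suc k))) m)
  rows-split P C m rewrite rows-++ P C 1 k (suc (suc m)) | +-comm k 1 =
    ⨾-cong (rows-cong P C 1 k)
      (⨾-cong (rows-columns P 1 C) (rows-cong P C (suc (suc (suc k))) m))

  -- D = Ψ(E) for i = k + 1; b is the column that absorbs the letter.
  record Lift (b : ℕ) (E D : Cells) : Set where
    field
      1≤b      : 1 ≤ b
      outside  : ∀ r c → (r ≢ suc k × r ≢ suc (suc k)) ⊎ c ≡ 0 ⊎ b < c → E r c ≡ D r c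
      D-upper  : ∀ c → 1 ≤ c → c ≤ b → D (suc k) c ≡ true
      E-lower  : ∀ c → 1 ≤ c → c < b → E (suc (suc k)) c ≡ true
      E-lower≡ : E (suc (suc k)) b ≡ false
      D-lower  : ∀ c → 1 ≤ c → c < b → D (suc (suc k)) c ≡ E (suc k) c
      D-lower≡ : D (suc (suc k)) b ≡ false

    right : ∀ c → b < c → SameColumn E D c
    right c l = outside (suc k) c (inj₂ (inj₂ l)) , outside (suc (suc k)) c (inj₂ (inj₂ l))

  -- The letter `a` behind column c, whose lower cell is full, comes out in front of it as `a + 1`,
  -- which is the upper letter of column c + 1, so the passage can be repeated there. For a full
  -- upper cell this is the braid relation; for an empty one both sides are the same word.
  column-token : ∀ p a →
    (when p a ⨾ when true (suc a) ⨾ sort a) ≋ (sort (suc a) ⨾ when true a ⨾ when p (suc a))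
  column-token true  a = sort-braid a
  column-token false a = ⨾-cong (sort-cong (suc a)) (sort-cong a)

  absorb : ∀ p a → (when p a ⨾ sort a) ≋ sort a
  absorb true  a = sort-idem a
  absorb false a = sort-cong a

  module _ {b E D} (L : Lift b E D) where
    open Lift L

    -- Induction along the columns: `column-token` moves the letter from column `c` to column
    -- `c + 1`, and at `b` idempotence absorbs it into the upper cell. The bound `b < c + n` ensures
    -- that column `b` is among those read.
    columns-token : ∀ c n → 1 ≤ c → c ≤ b → b < c + n →
      (columns E c n ⨾ sort (k + c)) ≋ columns D c n
    columns-token c zero    1≤c c≤b b<c = ⊥-elim (<⇒≱ b<c (subst (_≤ b) (sym (+-identityʳ c)) c≤b))
    columns-token c (suc n) 1≤c c≤b b<c with m≤n⇒m<n∨m≡n c≤b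
    ... | inj₂ refl rewrite E-lower≡ | D-lower≡ | D-upper c 1≤c ≤-refl =
      ⨾-cong (columns-≡ E D (suc c) n λ x l → right x l) (absorb (E (suc k) c) (k + c))
    ... | inj₁ c<b rewrite E-lower c 1≤c c<b | D-lower c 1≤c c<b | D-upper c 1≤c c≤b =
      ⨾-cong (columns-≡ E E (suc c) n λ _ _ → refl , refl) (column-token (E (suc k) c) (k + c))
      ⟫ ⨾-cong (subst (λ a → (columns E (suc c) n ⨾ sort a) ≋ columns D (suc c) n) (+-suc k c)
                  (columns-token (suc c) n (m≤n⇒m≤1+n 1≤c) c<b (subst (b <_) (+-suc c n) b<c)))
               (⨾-cong (sort-cong (k + c)) (when-cong (E (suc k) c) _))

    -- Before `b` the lower row of D copies the upper row of E, and at `b` it is empty, which covers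
    -- `a ≡ b`. Hence the first gap of row i of E can be read off from D alone.
    FirstGap-lower : ∀ {a} → FirstGap (E (suc k)) a → a ≤ b → FirstGap (D (suc (suc k))) a
    FirstGap-lower {a} (1≤a , full , gap) a≤b =
      1≤a , (λ c 1≤c c<a → trans (D-lower c 1≤c (<-≤-trans c<a a≤b)) (full c 1≤c c<a)) , lower (m≤n⇒m<n∨m≡n a≤b)
      where
      lower : a < b ⊎ a ≡ b → D (suc (suc k)) a ≡ false
      lower (inj₁ a<b)  = trans (D-lower a 1≤a a<b) gap
      lower (inj₂ refl) = D-lower≡

  delete : ℕ → Cells → Cells
  delete a D r c = D r c ∧ not ((r ≡ᵇ suc k) ∧ (c ≡ᵇ a))

  delete-upper : ∀ a D → delete a D (suc k) a ≡ false
  delete-upper a D rewrite dec-true (k ≟ k) refl | dec-true (a ≟ a) refl = ∧-zeroʳ (D (suc k) a)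

  delete-lower : ∀ a D c → delete a D (suc (suc k)) c ≡ D (suc (suc k)) c
  delete-lower a D c rewrite dec-false (suc k ≟ k) 1+n≢n = ∧-identityʳ _

  delete-apart : ∀ a D r c → c ≢ a → delete a D r c ≡ D r c
  delete-apart a D r c c≢a rewrite dec-false (c ≟ a) c≢a | ∧-zeroʳ (r ≡ᵇ suc k) = ∧-identityʳ _

  -- The cross of E at (k + 2, a) is the letter k + (a + 1), i.e. the travelling letter in front of column a + 1.
  columns-canonical : ∀ {b E D a} → Lift b E D → FirstGap (E (suc k)) a → a ≤ b →
    ∀ c n → 1 ≤ c → c ≤ a → b < c + n → columns E c n ≋ columns (delete a D) c n
  columns-canonical {b} {E} {D} {a} L g a≤b c zero 1≤c c≤a b<c =
    ⊥-elim (<⇒≱ b<c (subst (_≤ b) (sym (+-identityʳ c)) (≤-trans c≤a a≤b)))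
  columns-canonical {b} {E} {D} {a} L g@(1≤a , full , gap) a≤b c (suc n) 1≤c c≤a b<c
    with m≤n⇒m<n∨m≡n c≤a | m≤n⇒m<n∨m≡n a≤b
  -- Left of the gap both cells of the column are crosses in E and in D, the lower cell of D being a
  -- copy of the upper cell of E.
  ... | inj₁ c<a | _ =
    ⨾-cong (columns-canonical L g a≤b (suc c) n (m≤n⇒m≤1+n 1≤c) c<a (subst (b <_) (+-suc c n) b<c))
      (column-≡ E (delete a D) c
        ( trans (full c 1≤c c<a) (sym (trans (delete-apart a D _ c c≢a) (D-upper c 1≤c (≤-trans c≤a a≤b))))
        , trans (E-lower c 1≤c c<b) (sym (trans (delete-apart a D _ c c≢a) (trans (D-lower c 1≤c c<b) (full c 1≤c c<a))))))
    where
    open Lift L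
    c≢a = <⇒≢ c<a
    c<b = <-≤-trans c<a a≤b
  -- If the gap is the absorbing column itself, no letter travels: from here on E is D without the
  -- cross (i, a).
  ... | inj₂ refl | inj₂ refl =
    columns-≡ E (delete a D) c (suc n) λ x l → same x (m≤n⇒m<n∨m≡n l)
    where
    open Lift L
    same : ∀ x → a < x ⊎ a ≡ x → SameColumn E (delete a D) x
    same x (inj₁ l) = trans (proj₁ (right x l)) (sym (delete-apart a D _ x (≢-sym (<⇒≢ l))))
                    , trans (proj₂ (right x l)) (sym (delete-apart a D _ x (≢-sym (<⇒≢ l))))
    same x (inj₂ refl) = trans gap (sym (delete-upper a D))
                       , trans E-lower≡ (sym (trans (delete-lower a D a) D-lower≡))
  ... | inj₂ refl | inj₁ a<b rewrite gap | Lift.E-lower L a 1≤a a<b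
    | delete-upper a D | delete-lower a D a | Lift.D-lower L a 1≤a a<b | gap =
    subst (λ x → (columns E (suc a) n ⨾ sort x) ≋ columns D (suc a) n) (+-suc k a)
      (columns-token L (suc a) n (m≤n⇒m≤1+n 1≤a) a<b (subst (b <_) (+-suc a n) b<c))
    ⟫ columns-≡ D (delete a D) (suc a) n λ x l →
        sym (delete-apart a D _ x (≢-sym (<⇒≢ l))) , sym (delete-apart a D _ x (≢-sym (<⇒≢ l)))

-- Pipe dreams as lists of crosses

true-ext : ∀ {p q} → (p ≡ true → q ≡ true) → (q ≡ true → p ≡ true) → p ≡ q
true-ext {true}  {q}     f g = sym (f refl)
true-ext {false} {true}  f g = g refl
true-ext {false} {false} f g = refl

≡ᵇ-true : ∀ {m n} → (m ≡ᵇ n) ≡ true → m ≡ n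
≡ᵇ-true {m} {n} e = ≡ᵇ⇒≡ m n (subst T (sym e) _)

eqC-true : ∀ x y → eqC x y ≡ true → x ≡ y
eqC-true (r , c) (r′ , c′) e with r ≡ᵇ r′ in p | c ≡ᵇ c′ in q
eqC-true (r , c) (r′ , c′) e | true | true = cong₂ _,_ (≡ᵇ-true p) (≡ᵇ-true q)

eqC-refl : ∀ x → eqC x x ≡ true
eqC-refl (r , c) rewrite dec-true (r ≟ r) refl | dec-true (c ≟ c) refl = refl

isIn⇒∈ : ∀ x D → isIn x D ≡ true → x ∈ D
isIn⇒∈ x (y ∷ D) h with eqC x y in e
... | true  = here (eqC-true x y e)
... | false = there (isIn⇒∈ x D h)

∈⇒isIn : ∀ {x D} → x ∈ D → isIn x D ≡ true
∈⇒isIn {x} (here refl) rewrite eqC-refl x = refl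
∈⇒isIn {x} {y ∷ D} (there p) rewrite ∈⇒isIn p = ∨-zeroʳ (eqC x y)

cells : PD → Cells
cells D r c = isIn (r , c) D

cells-cong : ∀ {D E} → D ≈ E → ∀ r c → cells D r c ≡ cells E r c
cells-cong {D} {E} e r c = true-ext
  (λ h → ∈⇒isIn (proj₁ (e (r , c)) (isIn⇒∈ (r , c) D h)))
  (λ h → ∈⇒isIn (proj₂ (e (r , c)) (isIn⇒∈ (r , c) E h)))

cells-≈ : ∀ {D E} → (∀ r c → cells D r c ≡ cells E r c) → D ≈ E
cells-≈ {D} {E} e (r , c) =
  (λ p → isIn⇒∈ (r , c) E (trans (sym (e r c)) (∈⇒isIn p))) ,
  (λ p → isIn⇒∈ (r , c) D (trans (e r c) (∈⇒isIn p)))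

any-++ : ∀ {A : Set} (p : A → Bool) xs ys → any p (xs ++ ys) ≡ any p xs ∨ any p ys
any-++ p []       ys = refl
any-++ p (x ∷ xs) ys rewrite any-++ p xs ys = sym (∨-assoc (p x) _ _)

cells-++ : ∀ D E r c → cells (D ++ E) r c ≡ cells D r c ∨ cells E r c
cells-++ D E r c = any-++ (eqC (r , c)) D E

-- Only copies of `x` can satisfy `p`, so the filter treats all witnesses alike, by the value `f x`.
-- It applies to crosses as well as to column indices.
any-filterᵇ : ∀ {A : Set} (p f : A → Bool) x → (∀ y → p y ≡ true → x ≡ y) →
  ∀ xs → any p (filterᵇ f xs) ≡ any p xs ∧ f x
any-filterᵇ p f x h [] = refl
any-filterᵇ p f x h (y ∷ ys) with p y in e
any-filterᵇ p f x h (y ∷ ys) | false with f y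
... | false = any-filterᵇ p f x h ys
... | true rewrite e = any-filterᵇ p f x h ys
any-filterᵇ p f x h (y ∷ ys) | true with refl ← h y e with f x in e′
... | true rewrite e = refl
... | false = trans (any-filterᵇ p f x h ys) (trans (cong (any p ys ∧_) e′) (∧-zeroʳ _))

cells-filterᵇ : ∀ f D r c → cells (filterᵇ f D) r c ≡ cells D r c ∧ f (r , c)
cells-filterᵇ f D r c = any-filterᵇ (eqC (r , c)) f (r , c) (eqC-true (r , c)) D

cells-filterᵇ-++ : ∀ f D E r c → cells (filterᵇ f D ++ E) r c ≡ (cells D r c ∧ f (r , c)) ∨ cells E r c
cells-filterᵇ-++ f D E r c = trans (cells-++ (filterᵇ f D) E r c) (cong (_∨ cells E r c) (cells-filterᵇ f D r c))

infix 4 _∈ᵇ_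
_∈ᵇ_ : ℕ → List ℕ → Bool
c ∈ᵇ xs = any (c ≡ᵇ_) xs

∈ᵇ⇒∈ : ∀ c xs → (c ∈ᵇ xs) ≡ true → c ∈ xs
∈ᵇ⇒∈ c (x ∷ xs) h with c ≡ᵇ x in e
... | true  = here (≡ᵇ-true e)
... | false = there (∈ᵇ⇒∈ c xs h)

∈⇒∈ᵇ : ∀ {c xs} → c ∈ xs → (c ∈ᵇ xs) ≡ true
∈⇒∈ᵇ {c} (here refl) rewrite dec-true (c ≟ c) refl = refl
∈⇒∈ᵇ {c} {x ∷ xs} (there p) rewrite ∈⇒∈ᵇ p = ∨-zeroʳ (c ≡ᵇ x)

∈ᵇ-filterᵇ : ∀ c f xs → (c ∈ᵇ filterᵇ f xs) ≡ (c ∈ᵇ xs) ∧ f c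
∈ᵇ-filterᵇ c f xs = any-filterᵇ (c ≡ᵇ_) f c (λ _ → ≡ᵇ-true) xs

any-eqC : ∀ r c k xs → any (λ j → eqC (r , c) (k , j)) xs ≡ (r ≡ᵇ k) ∧ (c ∈ᵇ xs)
any-eqC r c k [] = sym (∧-zeroʳ (r ≡ᵇ k))
any-eqC r c k (x ∷ xs) rewrite any-eqC r c k xs with r ≡ᵇ k
... | true  = refl
... | false = refl

cells-row : ∀ r c k xs → cells (map (k ,_) xs) r c ≡ (r ≡ᵇ k) ∧ (c ∈ᵇ xs)
cells-row r c k xs = trans (cong (foldr _∨_ false) (sym (map-∘ xs))) (any-eqC r c k xs)

-- Intervals with a variable left end, whose recursion matches that of `row` and `rows`.
from : ℕ → ℕ → List ℕ
from c zero    = []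
from c (suc n) = c ∷ from (suc c) n

map-suc-from : ∀ c n → map suc (from c n) ≡ from (suc c) n
map-suc-from c zero    = refl
map-suc-from c (suc n) = cong (suc c ∷_) (map-suc-from (suc c) n)

upTo-from : ∀ n → upTo n ≡ from 0 n
upTo-from zero    = refl
upTo-from (suc n) = cong (0 ∷_) (trans (sym (map-upTo suc n)) (trans (cong (map suc) (upTo-from n)) (map-suc-from 0 n)))

range-from : ∀ n → range n ≡ from 1 n
range-from n = trans (cong (map suc) (upTo-from n)) (map-suc-from 0 n)

∈-from : ∀ {k} c n → k ∈ from c n → c ≤ k × k < c + n
∈-from c (suc n) (here refl) = ≤-refl , m<m+n c (s≤s z≤n)
∈-from {k} c (suc n) (there p) with ∈-from (suc c) n p
... | l , l′ = <⇒≤ l , subst (k <_) (sym (+-suc c n)) l′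

from-∈ : ∀ {k} c n → c ≤ k → k < c + n → k ∈ from c n
from-∈ {k} c zero    l l′ = ⊥-elim (<⇒≱ l′ (subst (_≤ k) (sym (+-identityʳ c)) l))
from-∈ {k} c (suc n) l l′ with m≤n⇒m<n∨m≡n l
... | inj₁ c<k  = there (from-∈ (suc c) n c<k (subst (k <_) (+-suc c n) l′))
... | inj₂ refl = here refl

∈-range : ∀ {k n} → k ∈ range n → 1 ≤ k × k ≤ n
∈-range {k} {n} p with ∈-from 1 n (subst (k ∈_) (range-from n) p)
... | l , s≤s l′ = l , l′

range-∈ : ∀ {k n} → 1 ≤ k → k ≤ n → k ∈ range n
range-∈ {k} {n} l l′ = subst (k ∈_) (sym (range-from n)) (from-∈ 1 n l (s≤s l′))

range-sorted : ∀ n → AllPairs _<_ (range n)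
range-sorted n = AllPairs.map⁺ (AllPairs.applyUpTo⁺₁ id n λ i<j _ → s≤s i<j)

-- The word of a pipe dream as a product of rows

act-++ : ∀ v w u → act (v ++ w) u ≡ act w (act v u)
act-++ v w u = foldl-++ (λ f a → sort a f) u v w

rowWord : Cells → ℕ → List ℕ → List ℕ
rowWord P r = concatMap (λ c → if P r c then (r + c ∸ 1) ∷ [] else [])

act-cell : ∀ P r c u → act (if P r c then (r + c ∸ 1) ∷ [] else []) u ≡ cell P r c u
act-cell P r c u with P r c
... | true  = refl
... | false = refl

act-row : ∀ P r c n u → act (rowWord P r (reverse (from c n))) u ≡ row P r c n u
act-row P r c zero    u = refl
act-row P r c (suc n) u = begin
  act (rowWord P r (reverse (c ∷ from (suc c) n))) u
    ≡⟨ cong (λ l → act (rowWord P r l) u) (unfold-reverse c (from (suc c) n)) ⟩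
  act (rowWord P r (reverse (from (suc c) n) ++ c ∷ [])) u
    ≡⟨ cong (λ l → act l u) (concatMap-++ _ (reverse (from (suc c) n)) (c ∷ [])) ⟩
  act (rowWord P r (reverse (from (suc c) n)) ++ rowWord P r (c ∷ [])) u
    ≡⟨ act-++ (rowWord P r (reverse (from (suc c) n))) _ u ⟩
  act (rowWord P r (c ∷ [])) (act (rowWord P r (reverse (from (suc c) n))) u)
    ≡⟨ cong (act (rowWord P r (c ∷ []))) (act-row P r (suc c) n u) ⟩
  act (rowWord P r (c ∷ [])) (row P r (suc c) n u)
    ≡⟨ cong (λ l → act l (row P r (suc c) n u)) (++-identityʳ (if P r c then _ else [])) ⟩
  act (if P r c then (r + c ∸ 1) ∷ [] else []) (row P r (suc c) n u)
    ≡⟨ act-cell P r c _ ⟩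
  cell P r c (row P r (suc c) n u) ∎
  where
  open ≡-Reasoning

act-rows : ∀ P C r n u → act (concatMap (λ r → rowWord P r (reverse (from 1 C))) (from r n)) u ≡ rows P C r n u
act-rows P C r zero    u = refl
act-rows P C r (suc n) u =
  trans (act-++ (rowWord P r (reverse (from 1 C))) _ u)
    (trans (act-rows P C (suc r) n _) (cong (rows P C (suc r) n) (act-row P r 1 C u)))

∈-maxCoord : ∀ {x D} → x ∈ D → proj₁ x ≤ maxCoord D × proj₂ x ≤ maxCoord D
∈-maxCoord {x} {_ ∷ D} (here refl) =
  ≤-trans (m≤m⊔n _ (proj₂ x)) (m≤m⊔n _ (maxCoord D)) , ≤-trans (m≤n⊔m (proj₁ x) _) (m≤m⊔n _ (maxCoord D))
∈-maxCoord {x} {y ∷ D} (there p) with ∈-maxCoord p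
... | l , l′ = ≤-trans l (m≤n⊔m (proj₁ y ⊔ proj₂ y) _) , ≤-trans l′ (m≤n⊔m (proj₁ y ⊔ proj₂ y) _)

cells-bounded : ∀ D r c → maxCoord D < r ⊎ maxCoord D < c → cells D r c ≡ false
cells-bounded D r c h with isIn (r , c) D in e
... | false = refl
... | true with ∈-maxCoord (isIn⇒∈ (r , c) D e) | h
...   | l , _  | inj₁ k = ⊥-elim (<⇒≱ k l)
...   | _ , l′ | inj₂ k = ⊥-elim (<⇒≱ k l′)

word-rows : ∀ D B → maxCoord D ≤ B → act (word D) ≋ rows (cells D) B 1 B
word-rows D B l = ≋-sym (rows-extend (cells D) (maxCoord D) B l (cells-bounded D) ⟫
  λ {u} {v} e k → trans (rows-≋ (cells D) (cells D) M M 1 M (λ x _ _ → row-cong (cells D) x 1 M) e k)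
    (sym (cong (λ f → f k) (expand v))))
  where
  M = maxCoord D
  expand : ∀ v → act (word D) v ≡ rows (cells D) M 1 M v
  expand v = trans (cong (λ l → act (concatMap (λ r → rowWord (cells D) r (reverse l)) l) v) (range-from M))
    (act-rows (cells D) M 1 M v)

word-positive : ∀ D → All (1 ≤_) (word D)
word-positive D = All.concat⁺ (All.map⁺ (All.tabulate λ {r} r∈ →
  All.concat⁺ (All.map⁺ (All.tabulate λ {c} c∈ → letter r c (∈-range r∈) (reverse-∈ c∈)))))
  where
  reverse-∈ : ∀ {c} → c ∈ reverse (range (maxCoord D)) → 1 ≤ c × c ≤ maxCoord D
  reverse-∈ p = ∈-range (reverse⁻ p)
  letter : ∀ r c → 1 ≤ r × r ≤ maxCoord D → 1 ≤ c × c ≤ maxCoord D →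
    All (1 ≤_) (if cells D r c then (r + c ∸ 1) ∷ [] else [])
  letter r c (1≤r , _) (1≤c , _) with cells D r c
  ... | false = []
  ... | true  = ∸-monoˡ-≤ 1 (+-mono-≤ 1≤r 1≤c) ∷ []

demazure-word : ∀ D → demazure (word D) ≗ act (word D) id
demazure-word D = demazure-act (word D) (word-positive D)

-- Mitosis

-- A pigeonhole argument, removing one cross at a time; it shows that the fuel `length D` in `start`
-- suffices.
row-length : ∀ r (D : PD) n → (∀ c → 1 ≤ c → c ≤ n → (r , c) ∈ D) → n ≤ length D
row-length r D zero    h = z≤n
row-length r D (suc n) h with ∈-∃++ (h (suc n) (s≤s z≤n) ≤-refl)
... | xs , ys , refl = subst (suc n ≤_) (sym length-split)
    (s≤s (row-length r (xs ++ ys) n λ c 1≤c c≤n → drop-mid c c≤n (∈-++⁻ xs (h c 1≤c (m≤n⇒m≤1+n c≤n)))))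
  where
  length-split : length (xs ++ (r , suc n) ∷ ys) ≡ suc (length (xs ++ ys))
  length-split = trans (length-++ xs) (trans (+-suc (length xs) (length ys)) (cong suc (sym (length-++ xs))))
  drop-mid : ∀ c → c ≤ n → (r , c) ∈ xs ⊎ (r , c) ∈ (r , suc n) ∷ ys → (r , c) ∈ xs ++ ys
  drop-mid c c≤n (inj₁ p)           = ∈-++⁺ˡ p
  drop-mid c c≤n (inj₂ (there p))   = ∈-++⁺ʳ xs p
  drop-mid c c≤n (inj₂ (here refl)) = ⊥-elim (1+n≰n c≤n)

-- What the fuelled search guarantees by itself: `end` leaves open that it stopped for want of fuel.
record Scan (r : ℕ) (D : PD) (fuel first result : ℕ) : Set where
  field
    first≤ : first ≤ result
    full   : ∀ c → first ≤ c → c < result → cells D r c ≡ true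
    end    : cells D r result ≡ false ⊎ result ≡ fuel + first

scan-spec : ∀ r D (go : ℕ → ℕ → ℕ) → (∀ j → go 0 j ≡ j) →
  (∀ f j → go (suc f) j ≡ (if cells D r j then go f (suc j) else j)) → ∀ f j → Scan r D f j (go f j)
scan-spec r D go go-0 go-suc zero j rewrite go-0 j = record
  { first≤ = ≤-refl
  ; full   = λ c p q → ⊥-elim (<⇒≱ q p)
  ; end    = inj₂ refl }
scan-spec r D go go-0 go-suc (suc f) j rewrite go-suc f j with cells D r j in eq
... | false = record
  { first≤ = ≤-refl
  ; full   = λ c p q → ⊥-elim (<⇒≱ q p)
  ; end    = inj₁ eq }
... | true = record
  { first≤ = ≤-trans (n≤1+n j) first≤
  ; full   = full′
  ; end    = map₂ (λ e → trans e (+-suc f j)) end }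
  where
  open Scan (scan-spec r D go go-0 go-suc f (suc j))
  full′ : ∀ c → j ≤ c → c < go f (suc j) → cells D r c ≡ true
  full′ c p q with m≤n⇒m<n∨m≡n p
  ... | inj₁ l    = full c l q
  ... | inj₂ refl = eq

mutual
  -- The function go local to start has no name here; it is recovered by unification.
  scan : ℕ → PD → ℕ → ℕ → ℕ
  scan = _

  start-scan : ∀ r D → Scan r D (length D) 1 (start r D)
  -- With variables in place of `length D` and 1, the arguments of `scan` are distinct variables and
  -- unification has a unique solution.
  start-scan r D with length D | 1
  ... | n | m = scan-spec r D (scan r D) (λ _ → refl) (λ _ _ → refl) n m

-- If the fuel ran out at a cell that is still a cross, row `r` would contain `length D + 1`
-- crosses.
start-gap : ∀ r D → FirstGap (cells D r) (start r D)
start-gap r D = first≤ , full , gap end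
  where
  open Scan (start-scan r D)
  gap : cells D r (start r D) ≡ false ⊎ start r D ≡ length D + 1 → cells D r (start r D) ≡ false
  gap (inj₁ e) = e
  gap (inj₂ s≡) with cells D r (start r D) in eq
  ... | false = refl
  ... | true  = ⊥-elim (1+n≰n (subst (_≤ length D) (trans s≡ (+-comm _ 1))
        (row-length r D (start r D) λ c 1≤c c≤s → isIn⇒∈ (r , c) D (occupied c 1≤c (m≤n⇒m<n∨m≡n c≤s)))))
    where
    occupied : ∀ c → 1 ≤ c → c < start r D ⊎ c ≡ start r D → cells D r c ≡ true
    occupied c 1≤c (inj₁ l)    = full c 1≤c l
    occupied c 1≤c (inj₂ refl) = eq

∈ᵇ-range : ∀ {c n} → 1 ≤ c → c ≤ n → (c ∈ᵇ range n) ≡ true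
∈ᵇ-range 1≤c c≤n = ∈⇒∈ᵇ (range-∈ 1≤c c≤n)

∉ᵇ-range : ∀ {c n} → ¬ (1 ≤ c × c ≤ n) → (c ∈ᵇ range n) ≡ false
∉ᵇ-range {c} {n} h with c ∈ᵇ range n in e
... | false = refl
... | true  = ⊥-elim (h (∈-range (∈ᵇ⇒∈ c (range n) e)))

Valid : Cells → Set
Valid P = ∀ r c → P r c ≡ true → 1 ≤ r × 1 ≤ c

valid⇒ : ∀ {D} → ValidPD D → Valid (cells D)
valid⇒ {D} v r c h = All.lookup v (isIn⇒∈ (r , c) D h)

valid⇐ : ∀ {D} → Valid (cells D) → ValidPD D
valid⇐ v = All.tabulate λ {x} x∈ → v (proj₁ x) (proj₂ x) (∈⇒isIn x∈)

column-0 : ∀ {P} → Valid P → ∀ r → P r 0 ≡ false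
column-0 {P} v r with P r 0 in e
... | false = refl
... | true with () ← proj₂ (v r 0 e)

𝒥-sorted : ∀ r D → AllPairs _<_ (𝒥 r D)
𝒥-sorted r D = AllPairs.filter⁺ (T? ∘ λ j → not (isIn (suc r , j) D)) (range-sorted (start r D ∸ 1))

<⇒≤∸1 : ∀ {m n} → m < n → m ≤ n ∸ 1
<⇒≤∸1 (s≤s l) = l

≤∸1⇒< : ∀ {m n} → 1 ≤ n → m ≤ n ∸ 1 → m < n
≤∸1⇒< (s≤s _) l = s≤s l

∈ᵇ-𝒥 : ∀ r D c → (c ∈ᵇ 𝒥 r D) ≡ (c ∈ᵇ range (start r D ∸ 1)) ∧ not (cells D (suc r) c)
∈ᵇ-𝒥 r D c = ∈ᵇ-filterᵇ c (λ j → not (isIn (suc r , j) D)) (range (start r D ∸ 1))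

∈-𝒥 : ∀ {r D c} → c ∈ 𝒥 r D → 1 ≤ c × c < start r D × cells D (suc r) c ≡ false
∈-𝒥 {r} {D} {c} c∈ with c ∈ᵇ range (start r D ∸ 1) in e | cells D (suc r) c in e′ | trans (sym (∈ᵇ-𝒥 r D c)) (∈⇒∈ᵇ c∈)
... | true | false | refl with ∈-range (∈ᵇ⇒∈ c (range (start r D ∸ 1)) e)
...   | l , l′ = l , ≤∸1⇒< (proj₁ (start-gap r D)) l′ , refl

𝒥-∈ : ∀ {r D c} → 1 ≤ c → c < start r D → cells D (suc r) c ≡ false → c ∈ 𝒥 r D
𝒥-∈ {r} {D} {c} 1≤c c<s e = ∈ᵇ⇒∈ c (𝒥 r D) (trans (∈ᵇ-𝒥 r D c)
  (cong₂ (λ p q → p ∧ not q) (∈ᵇ-range 1≤c (<⇒≤∸1 c<s)) e))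

∉ᵇ-𝒥 : ∀ r D c → cells D (suc r) c ≡ true → (c ∈ᵇ 𝒥 r D) ≡ false
∉ᵇ-𝒥 r D c e rewrite ∈ᵇ-𝒥 r D c | e = ∧-zeroʳ _

0∉ᵇ-𝒥 : ∀ r D → (0 ∈ᵇ 𝒥 r D) ≡ false
0∉ᵇ-𝒥 r D = trans (∈ᵇ-𝒥 r D 0) (cong (_∧ not (cells D (suc r) 0)) (∉ᵇ-range {0} {start r D ∸ 1} λ ()))

-- The cells of `Dp`

cells-Dp : ∀ i D p r c → cells (Dp i D p) r c ≡
  (cells D r c ∧ not ((r ≡ᵇ i) ∧ (c ≡ᵇ p) ∨ (r ≡ᵇ i) ∧ ((c ∈ᵇ 𝒥 i D) ∧ (c <ᵇ p))))
  ∨ (r ≡ᵇ suc i) ∧ ((c ∈ᵇ 𝒥 i D) ∧ (c <ᵇ p))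
cells-Dp i D p r c = trans (cells-filterᵇ-++ _ D (map (suc i ,_) J<) r c) (cong₂ _∨_
  (cong (λ b → cells D r c ∧ not ((r ≡ᵇ i) ∧ (c ≡ᵇ p) ∨ b))
    (trans (any-eqC r c i J<) (cong ((r ≡ᵇ i) ∧_) (∈ᵇ-filterᵇ c (_<ᵇ p) (𝒥 i D)))))
  (trans (cells-row r c (suc i) J<) (cong ((r ≡ᵇ suc i) ∧_) (∈ᵇ-filterᵇ c (_<ᵇ p) (𝒥 i D)))))
  where
  J< : List ℕ
  J< = filterᵇ (_<ᵇ p) (𝒥 i D)

module _ (k : ℕ) where
  private
    i = suc k

  Dp-upper : ∀ D p c → cells (Dp i D p) i c ≡
    cells D i c ∧ not ((c ≡ᵇ p) ∨ (c ∈ᵇ 𝒥 i D) ∧ (c <ᵇ p))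
  Dp-upper D p c rewrite cells-Dp i D p i c | dec-true (i ≟ i) refl | dec-false (i ≟ suc i) (≢-sym 1+n≢n) = ∨-identityʳ _

  Dp-lower : ∀ D p c → cells (Dp i D p) (suc i) c ≡ cells D (suc i) c ∨ (c ∈ᵇ 𝒥 i D) ∧ (c <ᵇ p)
  Dp-lower D p c rewrite cells-Dp i D p (suc i) c | dec-true (suc i ≟ suc i) refl | dec-false (suc i ≟ i) 1+n≢n
    | ∧-identityʳ (cells D (suc i) c) = refl

  Dp-other : ∀ D p r c → r ≢ i → r ≢ suc i → cells (Dp i D p) r c ≡ cells D r c
  Dp-other D p r c r≢i r≢i+1 rewrite cells-Dp i D p r c | dec-false (r ≟ i) r≢i | dec-false (r ≟ suc i) r≢i+1
    | ∧-identityʳ (cells D r c) = ∨-identityʳ _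

  ∈-𝒥-upper : ∀ {D p} → p ∈ 𝒥 i D → ∀ c → 1 ≤ c → c ≤ p → cells D i c ≡ true
  ∈-𝒥-upper {D} p∈ c 1≤c c≤p = proj₁ (proj₂ (start-gap i D)) c 1≤c (≤-<-trans c≤p (proj₁ (proj₂ (∈-𝒥 {i} {D} p∈))))

  -- Left of `p` the upper row of D is full. Columns with a full lower cell stay as they are; the
  -- others lie in `𝒥` and their cross moves down. In both cases the upper cell of `Dp` equals the
  -- lower cell of D.
  Dp-lift : ∀ {D p} → p ∈ 𝒥 i D → Lift k p (cells (Dp i D p)) (cells D)
  Dp-lift {D} {p} p∈ with ∈-𝒥 {i} {D} p∈
  ... | 1≤p , p<s , gap = record
    { 1≤b = 1≤p ; outside = outside ; D-upper = ∈-𝒥-upper {D} p∈ ; E-lower = λ c 1≤c c<p → E-lower c 1≤c c<p _ refl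
    ; E-lower≡ = E-lower≡ ; D-lower = λ c 1≤c c<p → D-lower c 1≤c c<p _ refl ; D-lower≡ = gap }
    where
    unchanged : ∀ r c → (c ≡ᵇ p) ≡ false → (c ∈ᵇ 𝒥 i D) ∧ (c <ᵇ p) ≡ false → cells (Dp i D p) r c ≡ cells D r c
    unchanged r c e e′ rewrite cells-Dp i D p r c | e | e′ | ∧-zeroʳ (r ≡ᵇ i) | ∧-zeroʳ (r ≡ᵇ suc i)
      | ∧-identityʳ (cells D r c) = ∨-identityʳ _
    outside : ∀ r c → (r ≢ i × r ≢ suc i) ⊎ c ≡ 0 ⊎ p < c → cells (Dp i D p) r c ≡ cells D r c
    outside r c (inj₁ (h , h′)) = Dp-other D p r c h h′
    outside r c (inj₂ (inj₁ refl)) = unchanged r 0 (dec-false (0 ≟ p) (<⇒≢ 1≤p)) (cong (_∧ (0 <ᵇ p)) (0∉ᵇ-𝒥 i D))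
    outside r c (inj₂ (inj₂ p<c)) = unchanged r c (dec-false (c ≟ p) (≢-sym (<⇒≢ p<c)))
      (trans (cong ((c ∈ᵇ 𝒥 i D) ∧_) (dec-false (c <? p) (<⇒≯ p<c))) (∧-zeroʳ _))
    member : ∀ c → 1 ≤ c → c < p → cells D (suc i) c ≡ false → (c ∈ᵇ 𝒥 i D) ≡ true
    member c 1≤c c<p e = ∈⇒∈ᵇ (𝒥-∈ {i} {D} 1≤c (<-trans c<p p<s) e)
    E-lower : ∀ c → 1 ≤ c → c < p → ∀ q → cells D (suc i) c ≡ q → cells (Dp i D p) (suc i) c ≡ true
    E-lower c 1≤c c<p true  e rewrite Dp-lower D p c | e = refl
    E-lower c 1≤c c<p false e rewrite Dp-lower D p c | e | member c 1≤c c<p e = dec-true (c <? p) c<p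
    E-lower≡ : cells (Dp i D p) (suc i) p ≡ false
    E-lower≡ rewrite Dp-lower D p p | gap | dec-false (p <? p) (<-irrefl refl) = ∧-zeroʳ _
    D-lower : ∀ c → 1 ≤ c → c < p → ∀ q → cells D (suc i) c ≡ q → cells D (suc i) c ≡ cells (Dp i D p) i c
    D-lower c 1≤c c<p true e rewrite Dp-upper D p c | ∉ᵇ-𝒥 i D c e | dec-false (c ≟ p) (<⇒≢ c<p)
      | ∈-𝒥-upper {D} p∈ c 1≤c (<⇒≤ c<p) = e
    D-lower c 1≤c c<p false e rewrite Dp-upper D p c | member c 1≤c c<p e | dec-false (c ≟ p) (<⇒≢ c<p)
      | dec-true (c <? p) c<p | ∧-zeroʳ (cells D i c) = e

  Dp-gap : ∀ D p → cells (Dp i D p) i p ≡ false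
  Dp-gap D p rewrite Dp-upper D p p | dec-true (p ≟ p) refl = ∧-zeroʳ _

-- Neighbours in a sorted list

data Consecutive : List ℕ → ℕ → ℕ → Set where
  now   : ∀ {x y xs} → Consecutive (x ∷ y ∷ xs) x y
  later : ∀ {x y z xs} → Consecutive xs x y → Consecutive (z ∷ xs) x y

consecutive-∈ : ∀ {xs x y} → Consecutive xs x y → x ∈ xs × y ∈ xs
consecutive-∈ now = here refl , there (here refl)
consecutive-∈ (later C) with consecutive-∈ C
... | p , q = there p , there q

consecutive-< : ∀ {xs x y} → AllPairs _<_ xs → Consecutive xs x y → x < y
consecutive-< ((x<y ∷ _) ∷ _) now       = x<y
consecutive-< (_ ∷ s)         (later C) = consecutive-< s C

consecutive-gap : ∀ {xs x y z} → AllPairs _<_ xs → Consecutive xs x y → z ∈ xs → z < y → z ≤ x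
consecutive-gap s now (here refl) z<y = ≤-refl
consecutive-gap s now (there (here refl)) z<y = ⊥-elim (<-irrefl refl z<y)
consecutive-gap (_ ∷ (y< ∷ _)) now (there (there z∈)) z<y = ⊥-elim (<-asym z<y (All.lookup y< z∈))
consecutive-gap (<xs ∷ _) (later C) (here refl) z<y = <⇒≤ (All.lookup <xs (proj₁ (consecutive-∈ C)))
consecutive-gap (_ ∷ s) (later C) (there z∈) z<y = consecutive-gap s C z∈ z<y

-- The smaller element `a` witnesses that `y` is not the head of the list.
predecessor : ∀ {xs a y} → AllPairs _<_ xs → a ∈ xs → y ∈ xs → a < y → ∃ λ x → Consecutive xs x y
predecessor s (here refl) (here refl) a<y = ⊥-elim (<-irrefl refl a<y)
predecessor (<xs ∷ _) (there a∈) (here refl) a<y = ⊥-elim (<-asym a<y (All.lookup <xs a∈))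
predecessor s (here refl) (there (here refl)) a<y = _ , now
predecessor ((_ ∷ _) ∷ s@(<xs ∷ _)) (here refl) (there (there y∈)) a<y
  with predecessor s (here refl) (there y∈) (All.lookup <xs y∈)
... | x , C = x , later C
predecessor (_ ∷ s) (there a∈) (there y∈) a<y with predecessor s a∈ y∈ a<y
... | x , C = x , later C

interleave⁻ : ∀ {E} (f : ℕ → PD) xs → E ∈PD interleave (map f xs) →
  (∃ λ x → x ∈ xs × E ≈ f x) ⊎ (∃₂ λ x y → Consecutive xs x y × E ≈ (f x ++ f y))
interleave⁻ f (x ∷ []) (here e) = inj₁ (x , here refl , e)
interleave⁻ f (x ∷ y ∷ xs) (here e) = inj₁ (x , here refl , e)
interleave⁻ f (x ∷ y ∷ xs) (there (here e)) = inj₂ (x , y , now , e)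
interleave⁻ f (x ∷ y ∷ xs) (there (there p)) with interleave⁻ f (y ∷ xs) p
... | inj₁ (z , z∈ , e)      = inj₁ (z , there z∈ , e)
... | inj₂ (z , t , C , e) = inj₂ (z , t , later C , e)

interleave-single : ∀ {E} (f : ℕ → PD) {x} xs → x ∈ xs → E ≈ f x → E ∈PD interleave (map f xs)
interleave-single f (x ∷ [])     (here refl) e = here e
interleave-single f (x ∷ y ∷ xs) (here refl) e = here e
interleave-single f (x ∷ y ∷ xs) (there p)   e = there (there (interleave-single f (y ∷ xs) p e))

interleave-pair : ∀ {E} (f : ℕ → PD) {x y} xs → Consecutive xs x y → E ≈ (f x ++ f y) → E ∈PD interleave (map f xs)
interleave-pair f (x ∷ y ∷ xs) now e = there (here e)
interleave-pair f (z ∷ t ∷ xs) (later C) e = there (there (interleave-pair f (t ∷ xs) C e))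

-- Unions of neighbours and the map Ψ

module _ (k : ℕ) where
  private
    i = suc k

  -- The union is `Dp i D y` with the cross (i, y) added: left of `x` both parts agree, in column
  -- `x` the first part has no cross, and strictly between `x` and `y` the lower row of D is full
  -- because the two are neighbours in `𝒥`. The empty cell (i, x) bounds the first gap of row i.
  Dp-∪-lift : ∀ {D x y} → Consecutive (𝒥 i D) x y →
    Lift k y (cells (Dp i D x ++ Dp i D y)) (cells D) × cells (Dp i D x ++ Dp i D y) i y ≡ true × cells (Dp i D x ++ Dp i D y) i x ≡ false
  Dp-∪-lift {D} {x} {y} C with consecutive-∈ C | consecutive-< (𝒥-sorted i D) C
  ... | x∈ , y∈ | x<y = record
      { 1≤b = Y.1≤b
      ; outside = λ r c h → trans (∪ r c) (trans (cong₂ _∨_ (X.outside r c (weaken h)) (Y.outside r c h)) (∨-idem _))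
      ; D-upper = Y.D-upper
      ; E-lower = λ c 1≤c c<y → trans (∪ (suc i) c) (trans (cong (cells (Dp i D x) (suc i) c ∨_) (Y.E-lower c 1≤c c<y)) (∨-zeroʳ _))
      ; E-lower≡ = trans (∪ (suc i) y) (cong₂ _∨_ (trans (X.outside (suc i) y (inj₂ (inj₂ x<y))) Y.D-lower≡) Y.E-lower≡)
      ; D-lower = λ c 1≤c c<y → trans (D-lower c 1≤c c<y (<-cmp c x)) (sym (∪ i c))
      ; D-lower≡ = Y.D-lower≡ }
    , trans (∪ i y) (cong (_∨ cells (Dp i D y) i y) (trans (X.outside i y (inj₂ (inj₂ x<y))) (Y.D-upper y Y.1≤b ≤-refl)))
    , trans (∪ i x) (cong₂ _∨_ (Dp-gap k D x) (trans (sym (Y.D-lower x X.1≤b x<y)) X.D-lower≡))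
    where
    module X = Lift (Dp-lift k {D} x∈)
    module Y = Lift (Dp-lift k {D} y∈)
    ∪ = cells-++ (Dp i D x) (Dp i D y)
    weaken : ∀ {r c} → (r ≢ i × r ≢ suc i) ⊎ c ≡ 0 ⊎ y < c → (r ≢ i × r ≢ suc i) ⊎ c ≡ 0 ⊎ x < c
    weaken (inj₁ h)        = inj₁ h
    weaken (inj₂ (inj₁ h)) = inj₂ (inj₁ h)
    weaken (inj₂ (inj₂ h)) = inj₂ (inj₂ (<-trans x<y h))
    between : ∀ c → 1 ≤ c → c < y → x < c → cells D (suc i) c ≡ true
    between c 1≤c c<y x<c with cells D (suc i) c in e
    ... | true  = refl
    ... | false = ⊥-elim (<⇒≱ x<c (consecutive-gap (𝒥-sorted i D) C
      (𝒥-∈ {i} {D} 1≤c (<-trans c<y (proj₁ (proj₂ (∈-𝒥 {i} {D} y∈)))) e) c<y))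
    D-lower : ∀ c → 1 ≤ c → c < y → _ → cells D (suc i) c ≡ cells (Dp i D x) i c ∨ cells (Dp i D y) i c
    D-lower c 1≤c c<y (tri< c<x _ _) = trans (sym (∨-idem _)) (cong₂ _∨_ (X.D-lower c 1≤c c<x) (Y.D-lower c 1≤c c<y))
    D-lower c 1≤c c<y (tri≈ _ refl _) = trans (Y.D-lower c 1≤c c<y) (cong (_∨ cells (Dp i D y) i c) (sym (Dp-gap k D c)))
    D-lower c 1≤c c<y (tri> _ _ x<c) = trans (between c 1≤c c<y x<c) (cong (_∨ cells (Dp i D y) i c)
      (sym (trans (X.outside i c (inj₂ (inj₂ x<c))) (Y.D-upper c 1≤c (<⇒≤ c<y)))))

  -- The map Ψ for the absorbing column `b`. When row i + 1 is full before `b`, deleting its crosses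
  -- below empty cells copies row i into it.
  raise : ℕ → PD → PD
  raise b E =
    filterᵇ (λ { (r , c) → not ((r ≡ᵇ suc i) ∧ ((c <ᵇ b) ∧ not (cells E i c))) }) E ++ map (i ,_) (range b)

  cells-raise : ∀ b E r c → cells (raise b E) r c ≡
    (cells E r c ∧ not ((r ≡ᵇ suc i) ∧ ((c <ᵇ b) ∧ not (cells E i c)))) ∨ (r ≡ᵇ i) ∧ (c ∈ᵇ range b)
  cells-raise b E r c = trans (cells-filterᵇ-++ _ E (map (i ,_) (range b)) r c)
    (cong ((cells E r c ∧ not ((r ≡ᵇ suc i) ∧ ((c <ᵇ b) ∧ not (cells E i c)))) ∨_) (cells-row r c i (range b)))

  raise-lift : ∀ {b E} → Valid (cells E) → FirstGap (cells E (suc i)) b → Lift k b (cells E) (cells (raise b E))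
  raise-lift {b} {E} v (1≤b , full , gap) = record
    { 1≤b = 1≤b ; outside = λ r c h → sym (outside r c h) ; D-upper = D-upper ; E-lower = full ; E-lower≡ = gap
    ; D-lower = D-lower ; D-lower≡ = D-lower≡ }
    where
    outside : ∀ r c → (r ≢ i × r ≢ suc i) ⊎ c ≡ 0 ⊎ b < c → cells (raise b E) r c ≡ cells E r c
    outside r c (inj₁ (h , h′)) rewrite cells-raise b E r c | dec-false (r ≟ i) h | dec-false (r ≟ suc i) h′
      | ∧-identityʳ (cells E r c) = ∨-identityʳ _
    -- The test `c <ᵇ b` of the filter also admits c = 0; validity of E ensures that there is
    -- nothing to delete.
    outside r c (inj₂ (inj₁ refl)) rewrite cells-raise b E r 0 | column-0 v r | ∉ᵇ-range {0} {b} (λ ()) = ∧-zeroʳ _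
    outside r c (inj₂ (inj₂ b<c)) rewrite cells-raise b E r c | dec-false (c <? b) (<⇒≯ b<c)
      | ∉ᵇ-range {c} {b} (λ h → <⇒≱ b<c (proj₂ h)) | ∧-zeroʳ (r ≡ᵇ suc i) | ∧-zeroʳ (r ≡ᵇ i)
      | ∧-identityʳ (cells E r c) = ∨-identityʳ _
    D-upper : ∀ c → 1 ≤ c → c ≤ b → cells (raise b E) i c ≡ true
    D-upper c 1≤c c≤b rewrite cells-raise b E i c | dec-true (i ≟ i) refl | ∈ᵇ-range 1≤c c≤b = ∨-zeroʳ _
    D-lower : ∀ c → 1 ≤ c → c < b → cells (raise b E) (suc i) c ≡ cells E i c
    D-lower c 1≤c c<b rewrite cells-raise b E (suc i) c | full c 1≤c c<b | dec-true (suc i ≟ suc i) refl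
      | dec-false (suc i ≟ i) 1+n≢n | dec-true (c <? b) c<b | not-involutive (cells E i c) = ∨-identityʳ _
    D-lower≡ : cells (raise b E) (suc i) b ≡ false
    D-lower≡ rewrite cells-raise b E (suc i) b | gap | dec-false (suc i ≟ i) 1+n≢n = refl

All-witness : ∀ {A : Set} {P : A → Set} {xs} → ¬ (xs ≡ []) → All P xs → ∃ P
All-witness nonempty []       = ⊥-elim (nonempty refl)
All-witness nonempty (p ∷ _) = _ , p

FirstGap-≤ : ∀ {p a x} → FirstGap p a → 1 ≤ x → p x ≡ false → a ≤ x
FirstGap-≤ {a = a} {x} (_ , full , _) 1≤x e with a ≤? x
... | yes p = p
... | no p with () ← trans (sym e) (full x 1≤x (≰⇒> p))

-- The preimages of a pipe dream under Ψ

module _ (k : ℕ) where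
  private
    i = suc k

  data Zone (b : ℕ) : ℕ → ℕ → Set where
    outside : ∀ {r c} → (r ≢ i × r ≢ suc i) ⊎ c ≡ 0 ⊎ b < c → Zone b r c
    upper   : ∀ {c} → 1 ≤ c → c < b → Zone b i c
    lower   : ∀ {c} → 1 ≤ c → c < b → Zone b (suc i) c
    upper≡  : Zone b i b
    lower≡  : Zone b (suc i) b

  zone : ∀ b r c → Zone b r c
  zone b r zero = outside (inj₂ (inj₁ refl))
  zone b r c@(suc _) with r ≟ i | r ≟ suc i | <-cmp c b
  ... | no p     | no q     | _             = outside (inj₁ (p , q))
  ... | _        | _        | tri> _ _ l    = outside (inj₂ (inj₂ l))
  ... | yes refl | _        | tri< l _ _    = upper (s≤s z≤n) l
  ... | yes refl | _        | tri≈ _ refl _ = upper≡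
  ... | no _     | yes refl | tri< l _ _    = lower (s≤s z≤n) l
  ... | no _     | yes refl | tri≈ _ refl _ = lower≡

  Lift-gap : ∀ {b E D} → Lift k b E D → FirstGap (E (suc i)) b
  Lift-gap L = 1≤b , E-lower , E-lower≡
    where open Lift L

  -- Ψ is single-valued, since the absorbing column is the first gap of row i + 1 of E. The
  -- disjointness in both halves of the theorem rests on this.
  Lift-determines-D : ∀ {b b′ E D D′} → Lift k b E D → Lift k b′ E D′ → ∀ r c → D r c ≡ D′ r c
  Lift-determines-D {b} L L′ r c with refl ← FirstGap-unique (Lift-gap L) (Lift-gap L′) with zone b r c
  ... | outside h = trans (sym (Lift.outside L r c h)) (Lift.outside L′ r c h)
  ... | upper l m = trans (Lift.D-upper L c l (<⇒≤ m)) (sym (Lift.D-upper L′ c l (<⇒≤ m)))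
  ... | lower l m = trans (Lift.D-lower L c l m) (sym (Lift.D-lower L′ c l m))
  ... | upper≡    = trans (Lift.D-upper L b (Lift.1≤b L) ≤-refl) (sym (Lift.D-upper L′ b (Lift.1≤b L) ≤-refl))
  ... | lower≡    = trans (Lift.D-lower≡ L) (sym (Lift.D-lower≡ L′))

  -- For given D and `b`, the cell (i, b) is the only one that the fields of `Lift` leave free in E.
  Lift-determines-E : ∀ {b E E′ D} → Lift k b E D → Lift k b E′ D → E i b ≡ E′ i b → ∀ r c → E r c ≡ E′ r c
  Lift-determines-E {b} L L′ e r c with zone b r c
  ... | outside h = trans (Lift.outside L r c h) (sym (Lift.outside L′ r c h))
  ... | upper l m = trans (sym (Lift.D-lower L c l m)) (Lift.D-lower L′ c l m)
  ... | lower l m = trans (Lift.E-lower L c l m) (sym (Lift.E-lower L′ c l m))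
  ... | upper≡    = e
  ... | lower≡    = trans (Lift.E-lower≡ L) (sym (Lift.E-lower≡ L′))

  Lift-valid : ∀ {b E D} → Lift k b E D → Valid D → Valid E
  Lift-valid {b} L v r c h with zone b r c
  ... | outside o = v r c (trans (sym (Lift.outside L r c o)) h)
  ... | upper l _ = s≤s z≤n , l
  ... | lower l _ = s≤s z≤n , l
  ... | upper≡    = s≤s z≤n , Lift.1≤b L
  ... | lower≡    = s≤s z≤n , Lift.1≤b L

  Lift-valid⁻ : ∀ {b E D} → Lift k b E D → Valid E → Valid D
  Lift-valid⁻ {b} L v r c h with zone b r c
  ... | outside o = v r c (trans (Lift.outside L r c o) h)
  ... | upper l _ = s≤s z≤n , l
  ... | lower l _ = s≤s z≤n , l
  ... | upper≡    = s≤s z≤n , Lift.1≤b L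
  ... | lower≡    = s≤s z≤n , Lift.1≤b L

  Lift-resp : ∀ {b E E′ D} → (∀ r c → E r c ≡ E′ r c) → Lift k b E D → Lift k b E′ D
  Lift-resp e L = record
    { 1≤b = 1≤b ; D-upper = D-upper ; D-lower≡ = D-lower≡
    ; outside  = λ r c h → trans (sym (e r c)) (Lift.outside L r c h)
    ; E-lower  = λ c l m → trans (sym (e (suc i) c)) (E-lower c l m)
    ; E-lower≡ = trans (sym (e (suc i) _)) E-lower≡
    ; D-lower  = λ c l m → trans (D-lower c l m) (e i c) }
    where open Lift L using (1≤b; D-upper; D-lower≡; E-lower; E-lower≡; D-lower)

  -- Says that Ψ(E) = D and that mitosis of E is empty: `b` is the first gap of row i + 1 of E, and
  -- the last condition leaves no such gap before the first gap of row i.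
  Below : PD → PD → Set
  Below E D = ∃ λ b → Lift k b (cells E) (cells D) × start i E ≤ b

  below : ∀ {F D b x} → Lift k b (cells F) (cells D) → 1 ≤ x → x ≤ b → cells F i x ≡ false →
    ∀ {E} → E ≈ F → Below E D
  below {F} {b = b} {x} L 1≤x x≤b gap {E} E≈F = b , Lift-resp (λ r c → sym (cells-cong E≈F r c)) L ,
    ≤-trans (FirstGap-≤ (start-gap i E) 1≤x (trans (cells-cong E≈F i x) gap)) x≤b

  Dp-below : ∀ {D p E} → p ∈ 𝒥 i D → E ≈ Dp i D p → Below E D
  Dp-below {D} {p} p∈ = below {Dp i D p} {D} L (Lift.1≤b L) ≤-refl (Dp-gap k D p)
    where
    L : Lift k p (cells (Dp i D p)) (cells D)
    L = Dp-lift k {D} p∈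

  mitosis′⇒below : ∀ {E D} → E ∈PD mitosis′ i D → Below E D
  mitosis′⇒below {E} {D} h with interleave⁻ (Dp i D) (𝒥 i D) h
  ... | inj₁ (p , p∈ , e) = Dp-below {D} p∈ e
  ... | inj₂ (x , y , C , e) with Dp-∪-lift k {D} C
  ...   | L , _ , gap = below {Dp i D x ++ Dp i D y} {D} L (proj₁ (∈-𝒥 {i} {D} (proj₁ (consecutive-∈ C))))
    (<⇒≤ (consecutive-< (𝒥-sorted i D) C)) gap e

  Lift-start : ∀ {b E D} → Lift k b E (cells D) → b < start i D
  Lift-start {b} {D = D} L with start i D ≤? b | start-gap i D
  ... | no p  | _ = ≰⇒> p
  ... | yes p | 1≤s , _ , gap with () ← trans (sym gap) (Lift.D-upper L _ 1≤s p)

  -- The cell (i, b) decides: if it is empty, E is `Dp i D b`; if it is a cross, E is the union of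
  -- `Dp i D x` and `Dp i D b` for the predecessor `x` of `b` in `𝒥 i D`. A predecessor exists
  -- because the first gap of row i of E is then smaller than `b` and belongs to `𝒥 i D`.
  below⇒mitosis′ : ∀ {E D} → Below E D → E ∈PD mitosis′ i D
  below⇒mitosis′ {E} {D} (b , L , a≤b) with cells E i b in e
  ... | false = interleave-single (Dp i D) (𝒥 i D) b∈
    (cells-≈ {E} {Dp i D b} (Lift-determines-E L (Dp-lift k {D} b∈) (trans e (sym (Dp-gap k D b)))))
    where
    b∈ : b ∈ 𝒥 i D
    b∈ = 𝒥-∈ {i} {D} (Lift.1≤b L) (Lift-start {D = D} L) (Lift.D-lower≡ L)
  ... | true = pair
    where
    1≤a = proj₁ (start-gap i E)
    gap = proj₂ (proj₂ (start-gap i E))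
    a<b : start i E < b
    a<b = ≤∧≢⇒< a≤b λ a≡b → absurd (trans (sym gap) (trans (cong (cells E i) a≡b) e))
      where
      absurd : false ≡ true → ⊥
      absurd ()
    b<s = Lift-start {D = D} L
    pair : E ∈PD mitosis′ i D
    pair with predecessor (𝒥-sorted i D)
      (𝒥-∈ {i} {D} 1≤a (<-trans a<b b<s) (trans (Lift.D-lower L _ 1≤a a<b) gap))
      (𝒥-∈ {i} {D} (Lift.1≤b L) b<s (Lift.D-lower≡ L)) a<b
    ... | x , C with Dp-∪-lift k {D} C
    ...   | L′ , e′ , _ = interleave-pair (Dp i D) (𝒥 i D) C
      (cells-≈ {E} {Dp i D x ++ Dp i D b} (Lift-determines-E L L′ (trans e (sym e′))))

  -- Products of the preimages

  act-word-split : ∀ D m → maxCoord D ≤ i + suc m → act (word D) ≋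
    (rows (cells D) (i + suc m) 1 k ⨾ columns k (cells D) 1 (i + suc m) ⨾ rows (cells D) (i + suc m) (suc (suc i)) m)
  act-word-split D m l =
    word-rows D (i + suc m) l ⟫
    subst (λ n → rows (cells D) (i + suc m) 1 n ≋
        (rows (cells D) (i + suc m) 1 k ⨾ columns k (cells D) 1 (i + suc m) ⨾ rows (cells D) (i + suc m) (suc (suc i)) m))
      (+-suc k (suc m)) (rows-split k (cells D) (i + suc m) m)

  SameOutside : PD → PD → Set
  SameOutside D E = ∀ r → r ≢ i → r ≢ suc i → ∀ c → cells D r c ≡ cells E r c

  rows-above : ∀ {D E} → SameOutside D E → ∀ C → rows (cells D) C 1 k ≋ rows (cells E) C 1 k
  rows-above {D} {E} h C = rows-≋ (cells D) (cells E) C C 1 k λ x _ x<i →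
    row-≡ (cells D) (cells E) x 1 C λ c _ → h x (<⇒≢ x<i) (<⇒≢ (m<n⇒m<1+n x<i)) c

  rows-below : ∀ {D E} → SameOutside D E → ∀ C m →
    rows (cells D) C (suc (suc i)) m ≋ rows (cells E) C (suc (suc i)) m
  rows-below {D} {E} h C m = rows-≋ (cells D) (cells E) C C (suc (suc i)) m λ x i+1<x _ →
    row-≡ (cells D) (cells E) x 1 C λ c _ → h x (≢-sym (<⇒≢ (<⇒≤ i+1<x))) (≢-sym (<⇒≢ i+1<x)) c

  -- The final s_i commutes back past the rows below i + 1. It is then the letter k + 1 behind
  -- column 1, and `columns-token` carries it to column `b`.
  act-word-lift : ∀ {b E D} → Lift k b (cells E) (cells D) → act (word D) ≋ (act (word E) ⨾ sort i)
  act-word-lift {b} {E} {D} L =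
    act-word-split D m D≤
    ⟫ ⨾-cong (rows-above {D} {E} same C)
        (⨾-cong (≋-sym token) (rows-below {D} {E} same C m)
        ⟫ ⨾-cong (columns-≡ k (cells E) (cells E) 1 C λ _ _ → refl , refl) (rows-after (cells E) C (suc (suc i)) m i ≤-refl))
    ⟫ ⨾-cong (≋-sym (act-word-split E m E≤)) (sort-cong i)
    where
    -- The common square of size `C` contains both pipe dreams and also the absorbing column.
    m = maxCoord D + maxCoord E + b
    C = i + suc m
    m≤C : m ≤ C
    m≤C = ≤-trans (n≤1+n m) (m≤n+m (suc m) i)
    D≤ : maxCoord D ≤ C
    D≤ = ≤-trans (m≤m+n _ _) (≤-trans (m≤m+n _ b) m≤C)
    E≤ : maxCoord E ≤ C
    E≤ = ≤-trans (m≤n+m _ (maxCoord D)) (≤-trans (m≤m+n _ b) m≤C)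
    same : SameOutside D E
    same r p q c = sym (Lift.outside L r c (inj₁ (p , q)))
    token : (columns k (cells E) 1 C ⨾ sort i) ≋ columns k (cells D) 1 C
    token = subst (λ a → (columns k (cells E) 1 C ⨾ sort a) ≋ columns k (cells D) 1 C) (+-comm k 1)
      (columns-token k L 1 C ≤-refl (Lift.1≤b L) (s≤s (≤-trans (m≤n+m b _) m≤C)))

  -- Both column products equal that of D without (i, a). By `FirstGap-lower`, `a` is the first gap
  -- of row i + 1 of D, so it is the same for E and E′.
  act-word-below : ∀ {D E E′} → Below E D → Below E′ D → act (word E) ≋ act (word E′)
  act-word-below {D} {E} {E′} (b , L , a≤b) (b′ , L′ , a′≤b′) =
    act-word-split E m E≤
    ⟫ ⨾-cong (rows-above {E} {E′} same C) (⨾-cong canonical (rows-below {E} {E′} same C m))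
    ⟫ ≋-sym (act-word-split E′ m E′≤)
    where
    m = maxCoord E + maxCoord E′ + (b + b′)
    C = i + suc m
    m≤C : m ≤ C
    m≤C = ≤-trans (n≤1+n m) (m≤n+m (suc m) i)
    E≤ : maxCoord E ≤ C
    E≤ = ≤-trans (m≤m+n _ _) (≤-trans (m≤m+n (maxCoord E + maxCoord E′) (b + b′)) m≤C)
    E′≤ : maxCoord E′ ≤ C
    E′≤ = ≤-trans (m≤n+m _ (maxCoord E)) (≤-trans (m≤m+n (maxCoord E + maxCoord E′) (b + b′)) m≤C)
    same : SameOutside E E′
    same r p q c = trans (Lift.outside L r c (inj₁ (p , q))) (sym (Lift.outside L′ r c (inj₁ (p , q))))
    a≡ : start i E ≡ start i E′
    a≡ = FirstGap-unique (FirstGap-lower k L (start-gap i E) a≤b) (FirstGap-lower k L′ (start-gap i E′) a′≤b′)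
    canonical : columns k (cells E) 1 C ≋ columns k (cells E′) 1 C
    canonical =
      subst (λ a → columns k (cells E) 1 C ≋ columns k (delete k a (cells D)) 1 C) a≡
        (columns-canonical k L (start-gap i E) a≤b 1 C ≤-refl (proj₁ (start-gap i E))
          (s≤s (≤-trans (≤-trans (m≤m+n b b′) (m≤n+m _ (maxCoord E + maxCoord E′))) m≤C)))
      ⟫ ≋-sym (columns-canonical k L′ (start-gap i E′) a′≤b′ 1 C ≤-refl (proj₁ (start-gap i E′))
          (s≤s (≤-trans (≤-trans (m≤n+m b′ b) (m≤n+m _ (maxCoord E + maxCoord E′))) m≤C)))

  -- Empty mitosis and membership in `𝒫`

  mitosis-[] : ∀ {E} → (∀ {p} → ¬ p ∈ 𝒥 i E) → mitosis i E ≡ []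
  mitosis-[] {E} h with 𝒥 i E
  ... | []    = refl
  ... | _ ∷ _ = ⊥-elim (h (here refl))

  mitosis-[]⁻ : ∀ {E p} → mitosis i E ≡ [] → ¬ p ∈ 𝒥 i E
  mitosis-[]⁻ {E} e p∈ with 𝒥 i E
  mitosis-[]⁻ e () | []
  mitosis-[]⁻ () p∈ | _ ∷ _

  below⇒mitosis-[] : ∀ {E D} → Below E D → mitosis i E ≡ []
  below⇒mitosis-[] {E} (b , L , a≤b) = mitosis-[] {E} no-𝒥
    where
    no-𝒥 : ∀ {p} → ¬ p ∈ 𝒥 i E
    no-𝒥 p∈ with ∈-𝒥 {i} {E} p∈
    ... | 1≤p , p<s , gap = <⇒≱ p<s (≤-trans a≤b (FirstGap-≤ (Lift-gap L) 1≤p gap))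

  mitosis-[]⇒start : ∀ {E} → mitosis i E ≡ [] → start i E ≤ start (suc i) E
  mitosis-[]⇒start {E} e with start i E ≤? start (suc i) E
  ... | yes p = p
  ... | no p  = ⊥-elim (mitosis-[]⁻ {E} e
    (𝒥-∈ {i} {E} (proj₁ (start-gap (suc i) E)) (≰⇒> p) (proj₂ (proj₂ (start-gap (suc i) E)))))

  mitosis-below : ∀ D → All (λ F → Below F D) (mitosis i D)
  mitosis-below D = All.map⁺ (All.tabulate λ p∈ → Dp-below {D} p∈ λ _ → id , id)

  𝒫-act : ∀ {v D} → 𝒫 v D → ∀ m → 1 ≤ m → act (word D) id m ≡ v m
  𝒫-act {D = D} (_ , h) m 1≤m = trans (sym (demazure-word D m)) (h m 1≤m)

  𝒫-below : ∀ {v D E F} → ValidPD D → Below E D → Below F D → 𝒫 v F → 𝒫 v E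
  𝒫-below {v} {D} {E} {F} valid E<D@(_ , L , _) F<D f =
    valid⇐ (Lift-valid L (valid⇒ valid)) ,
    λ m 1≤m → trans (demazure-word E m) (trans (act-word-below {D} {E} {F} E<D F<D (λ _ → refl) m) (𝒫-act {D = F} f m 1≤m))

  -- Covers both parts of the partition, with `v` being ws_i or w. The pipe dream D is Ψ(E); its
  -- product is `v` sorted at i, and all of mitosis of D lies `Below` D together with E and so
  -- shares the product of E.
  𝒫-raise : ∀ {v w E} → (∀ m → sort i v m ≡ w m) → 𝒫 v E → mitosis i E ≡ [] →
    Σ PD λ D → (𝒫 w D × ¬ (mitosis i D ≡ []) × All (𝒫 v) (mitosis i D)) × E ∈PD mitosis′ i D
  𝒫-raise {v} {w} {E} v→w PE@(valid , _) e =
    D , ((validD , product) , nonempty , All.map (λ F<D → 𝒫-below validD F<D E<D PE) (mitosis-below D)) , E∈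
    where
    b = start (suc i) E
    D = raise k b E
    L : Lift k b (cells E) (cells D)
    L = raise-lift k {b} {E} (valid⇒ valid) (start-gap (suc i) E)
    E<D : Below E D
    E<D = b , L , mitosis-[]⇒start {E} e
    E∈ : E ∈PD mitosis′ i D
    E∈ = below⇒mitosis′ {E} {D} E<D
    validD : ValidPD D
    validD = valid⇐ (Lift-valid⁻ L (valid⇒ valid))
    nonempty : ¬ (mitosis i D ≡ [])
    -- `interleave []` has no members, but E is one.
    nonempty e′ with () ← subst (λ l → E ∈PD interleave l) e′ E∈
    product : ∀ m → 1 ≤ m → demazure (word D) m ≡ w m
    product m 1≤m = trans (demazure-word D m) (trans (act-word-lift {b} {E} {D} L (λ _ → refl) m) (trans sorted (v→w m)))
      where
      sorted : sort i (act (word E) id) m ≡ sort i v m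
      sorted rewrite 𝒫-act {D = E} PE i (s≤s z≤n) | 𝒫-act {D = E} PE (suc i) (s≤s z≤n) | 𝒫-act {D = E} PE m 1≤m = refl

  -- Nonempty mitosis supplies one pipe dream with product `v`, and `act-word-below` transfers this
  -- product to E.
  𝒫-mitosis′ : ∀ {v w D E} → 𝒫 w D → ¬ (mitosis i D ≡ []) → All (𝒫 v) (mitosis i D) →
    E ∈PD mitosis′ i D → 𝒫 v E
  𝒫-mitosis′ {D = D} {E} (valid , _) nonempty all E∈ with All-witness nonempty (All.zip (all , mitosis-below D))
  ... | _ , PF , F<D = 𝒫-below valid (mitosis′⇒below {E} {D} E∈) F<D PF

  -- For p in `𝒥 i E`, the pipe dream E is Ψ of `Dp i E p`, so its product ends with sorting at i
  -- and cannot have an ascent there.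
  𝒫-ascent-[] : ∀ {v E} → v i < v (suc i) → 𝒫 v E → mitosis i E ≡ []
  𝒫-ascent-[] {v} {E} asc PE = mitosis-[] {E} no-𝒥
    where
    no-𝒥 : ∀ {p} → ¬ p ∈ 𝒥 i E
    no-𝒥 {p} p∈ = <⇒≱ asc (subst₂ _≤_ (𝒫-act {D = E} PE (suc i) (s≤s z≤n)) (𝒫-act {D = E} PE i (s≤s z≤n))
      (subst₂ _≤_ (sym (eq (suc i))) (sym (eq i)) (sort-sorts i (act (word (Dp i E p)) id))))
      where
      eq : ∀ m → act (word E) id m ≡ sort i (act (word (Dp i E p)) id) m
      eq = act-word-lift {p} {Dp i E p} {E} (Dp-lift k {E} p∈) λ _ → refl

  mitosis′-determines : ∀ {D D′ E} → E ∈PD mitosis′ i D → E ∈PD mitosis′ i D′ → D ≈ D′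
  mitosis′-determines {D} {D′} {E} E∈ E∈′ with mitosis′⇒below {E} {D} E∈ | mitosis′⇒below {E} {D′} E∈′
  ... | _ , L , _ | _ , L′ , _ = cells-≈ {D} {D′} (Lift-determines-D L L′)

theorem4p1 : (w : Perm) (i : ℕ) → 1 ≤ i → ℓ·s w i + 1 ≡ ℓ w →
    ((∀ D D' → 𝒫s w i D → 𝒫s w i D' → ¬ (D ≈ D') →
    ∀ E → E ∈PD mitosis′ i D → E ∈PD mitosis′ i D' → ⊥)
    × (∀ E → (𝒫 (fn w ·s i) E → Σ PD (λ D → 𝒫s w i D × E ∈PD mitosis′ i D))
    × (Σ PD (λ D → 𝒫s w i D × E ∈PD mitosis′ i D) → 𝒫 (fn w ·s i) E)))
    × ((∀ D D' → 𝒫I w i D → 𝒫I w i D' → ¬ (D ≈ D') →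
    ∀ E → E ∈PD mitosis′ i D → E ∈PD mitosis′ i D' → ⊥)
    × (∀ E → (𝒫∅ w i E → Σ PD (λ D → 𝒫I w i D × E ∈PD mitosis′ i D))
    × (Σ PD (λ D → 𝒫I w i D × E ∈PD mitosis′ i D) → 𝒫∅ w i E)))
theorem4p1 w i@(suc k) 1≤i len≡ =
  ( (λ D D′ _ _ D≉D′ E E∈ E∈′ → D≉D′ (mitosis′-determines k {D} {D′} {E} E∈ E∈′))
  -- Here `v` is ws_i: it has an ascent at i, so sorting gives back w and mitosis of E is empty.
  , λ E → (λ PE → 𝒫-raise k {E = E} (λ m → trans (sort-ascent i (fn w ·s i) (<⇒≤ asc) m) (cong (fn w) (swap-involutive i m))) PE
                    (𝒫-ascent-[] k {E = E} asc PE))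
        , λ { (D , (PD , nonempty , all) , E∈) → 𝒫-mitosis′ k {D = D} {E} PD nonempty all E∈ })
  , ( (λ D D′ _ _ D≉D′ E E∈ E∈′ → D≉D′ (mitosis′-determines k {D} {D′} {E} E∈ E∈′))
  -- Here `v` is w itself, which has a descent at i and is unchanged by sorting.
  , λ E → (λ { (PE , empty) → 𝒫-raise k {E = E} (sort-descent i (fn w) (<⇒≤ desc)) PE empty })
        , λ { (D , (PD , nonempty , all) , E∈) → 𝒫-mitosis′ k {D = D} {E} PD nonempty all E∈
                                                 , below⇒mitosis-[] k {E} {D} (mitosis′⇒below k {E} {D} E∈) })
  where
  desc : fn w (suc i) < fn w i
  desc = ℓ-descent w i 1≤i len≡
  asc : (fn w ·s i) i < (fn w ·s i) (suc i)
  asc = subst₂ _<_ (cong (fn w) (sym (atPair-here i))) (cong (fn w) (sym (atPair-next i))) desc
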